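{- Let $k\ge2$ and let $\mathcal{C}$ be a nondegenerate $[(k-1)m,k]_{q^m/q}$ code with linearity index $\ell=\ell(\mathcal{C})$. The following are equivalent. (1) $\mathcal{C}$ is minimal. (2) $\ell<k-2$. (3) $d^{\mathrm{rk}}_2(\mathcal{C})>m$.
   Context: Let $q$ be a prime power and $n,m,k$ positive integers. For $v\in\mathbb{F}_{q^m}^n$ and an ordered basis $\Gamma=(\gamma_1,\dots,\gamma_m)$ of $\mathbb{F}_{q^m}$ over $\mathbb{F}_q$, let $\Gamma(v)\in\mathbb{F}_q^{n\times m}$ be the matrix with $v_i=\sum_{j}\Gamma(v)_{ij}\gamma_j$. The rank support $\sigma^{\mathrm{rk}}(v)\subseteq\mathbb{F}_q^n$ is the column space of $\Gamma(v)$ (independent of $\Gamma$). An $[n,k]_{q^m/q}$ code is a $k$-dimensional $\mathbb{F}_{q^m}$-subspace $\mathcal{C}\subseteq\mathbb{F}_{q^m}^n$; it is nondegenerate if $\sum_{v\in\mathcal{C}}\sigma^{\mathrm{rk}}(v)=\mathbb{F}_q^n$, and minimal if for all $v,v'\in\mathcal{C}$, $\sigma^{\mathrm{rk}}(v')\subseteq\sigma^{\mathrm{rk}}(v)$ implies $v'=\alpha v$ for some $\alpha\in\mathbb{F}_{q^m}$. For a nondegenerate code $\mathcal{C}$ with generator matrix $G\in\mathbb{F}_{q^m}^{k\times n}$, let $\mathcal{U}\subseteq\mathbb{F}_{q^m}^k$ be the $\mathbb{F}_q$-span of the columns of $G$. The linearity index of $\mathcal{C}$ is $\ell(\mathcal{C})=\max\{\dim_{\mathbb{F}_{q^m}}(H):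 H\subseteq\mathbb{F}_{q^m}^k \text{ an } \mathbb{F}_{q^m}\text{ -subspace with } H\subseteq\mathcal{U}\}$; it does not depend on the choice of $G$. Let $\theta$ be the map $x\mapsto x^q$ applied componentwise to $\mathbb{F}_{q^m}^n$, and let $\Lambda_q(n,m)$ be the set of $\mathbb{F}_{q^m}$-subspaces $\mathcal{V}\le\mathbb{F}_{q^m}^n$ with $\theta(\mathcal{V})=\mathcal{V}$. For $1\le r\le k$, the $r$-th generalized rank weight is $d^{\mathrm{rk}}_r(\mathcal{C})=\min\{\dim_{\mathbb{F}_{q^m}}(\mathcal{V}):\mathcal{V}\in\Lambda_q(n,m),\ \dim_{\mathbb{F}_{q^m}}(\mathcal{V}\cap\mathcal{C})\ge r\}$. -}

module Defs where

open import Algebra.Bundles using (CommutativeRing)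
open import Algebra.Core using (Op₁; Op₂)
open import Algebra.Module.Bundles using (LeftModule)
open import Algebra.Module.Construct.TensorUnit using () renaming (leftModule to tensorUnit)
open import Algebra.Morphism.Structures using (IsRingHomomorphism)
open import Algebra.Structures using (IsCommutativeRing)
import Algebra.Properties.Semiring.Exp as Exp
open import Data.Fin.Base using (Fin)
open import Data.List.Base as List using (List)
open import Data.List.Relation.Unary.All using (All)
open import Data.Nat.Base as ℕ using (ℕ; _≤_)
open import Data.Nat.Primality using (Prime)
open import Data.Product.Base using (Σ; ∃; ∃₂; _×_; _,_; proj₁; proj₂)
open import Data.Unit.Base using (tt)
open import Data.Vec.Base using (Vec; []; _∷_; map; zipWith; replicate; foldr′; transpose)
open import Data.Vec.Properties
  using (map-id; map-cong; map-∘; map-replicate; zipWith-assoc; zipWith-comm;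
         zipWith-identityˡ; zipWith-identityʳ; zipWith-inverseˡ; zipWith-inverseʳ)
open import Data.Vec.Relation.Unary.All using () renaming (All to AllVec)
open import Function.Bundles using (_↔_)
open import Level using (0ℓ)
open import Relation.Binary.PropositionalEquality
  using (_≡_; _≢_; refl; trans; cong; cong₂; isEquivalence)
open import Relation.Unary using (Pred; U; _∈_; _⊆_; _≐_; _∩_)

IsPrimePower : ℕ → Set
IsPrimePower q = ∃₂ λ p e → Prime p × 1 ≤ e × q ≡ p ℕ.^ e

IsMaximum : ∀ {a} → Pred ℕ a → ℕ → Set a
IsMaximum S d = d ∈ S × (∀ e → e ∈ S → e ≤ d)

IsMinimum : ∀ {a} → Pred ℕ a → ℕ → Set a
IsMinimum S d = d ∈ S × (∀ e → e ∈ S → d ≤ e)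

-- Only finite fields are used below; every such field has a model in
-- which equality is propositional, so no setoid equality is carried.

record Field : Set₁ where
  infix  8 -_
  infixl 7 _*_
  infixl 6 _+_
  field
    Carrier           : Set
    _+_ _*_           : Op₂ Carrier
    -_                : Op₁ Carrier
    0# 1#             : Carrier
    isCommutativeRing : IsCommutativeRing _≡_ _+_ _*_ -_ 0# 1#
    0≢1               : 0# ≢ 1#
    inverse           : ∀ x → x ≢ 0# → ∃ λ y → x * y ≡ 1#

  commutativeRing : CommutativeRing 0ℓ 0ℓ
  commutativeRing = record { isCommutativeRing = isCommutativeRing }

  open CommutativeRing commutativeRing public using (ring; rawRing; semiring)
  open Exp semiring public using (_^_)

VectorSpace : Field → Set₁
VectorSpace F = LeftModule (Field.ring F) 0ℓ 0ℓ

module LinearAlgebra (F : Field) (M : VectorSpace F) where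
  open Field F using (Carrier; 0#)
  open LeftModule M using (_≈ᴹ_; _+ᴹ_; _*ₗ_; 0ᴹ) renaming (Carrierᴹ to V)

  linearCombination : ∀ {d} → Vec Carrier d → Vec V d → V
  linearCombination c b = foldr′ _+ᴹ_ 0ᴹ (zipWith _*ₗ_ c b)

  Span : ∀ {d} → Vec V d → Pred V 0ℓ
  Span b v = ∃ λ c → linearCombination c b ≈ᴹ v

  LinearlyIndependent : ∀ {d} → Vec V d → Set
  LinearlyIndependent {d} b =
    ∀ c → linearCombination c b ≈ᴹ 0ᴹ → c ≡ replicate d 0#

  record IsSubspace (P : Pred V 0ℓ) : Set where
    field
      ≈ᴹ-closed : ∀ {u v} → u ≈ᴹ v → u ∈ P → v ∈ P
      0ᴹ-closed : 0ᴹ ∈ P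
      +ᴹ-closed : ∀ {u v} → u ∈ P → v ∈ P → (u +ᴹ v) ∈ P
      *ₗ-closed : ∀ a {v} → v ∈ P → (a *ₗ v) ∈ P

  record IsBasis {d} (b : Vec V d) (P : Pred V 0ℓ) : Set where
    field
      members     : AllVec P b
      independent : LinearlyIndependent b
      spanning    : P ⊆ Span b

  HasDimension : Pred V 0ℓ → ℕ → Set
  HasDimension P d = ∃ λ (b : Vec V d) → IsBasis b P

  -- Σ_{i ∈ I} S i: finite sums whose terms each lie in some S i with i ∈ I.
  SumOfFamily : {A : Set} → Pred A 0ℓ → (A → Pred V 0ℓ) → Pred V 0ℓ
  SumOfFamily I S w = ∃ λ (ws : List V) →
    All (λ u → ∃ λ i → i ∈ I × u ∈ S i) ws × List.foldr _+ᴹ_ 0ᴹ ws ≈ᴹ w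

coordinateSpace : (F : Field) → ℕ → VectorSpace F
coordinateSpace F n = record
  { Carrierᴹ = Vec Carrier n
  ; _≈ᴹ_     = _≡_
  ; _+ᴹ_     = zipWith _+_
  ; _*ₗ_     = λ a → map (a *_)
  ; 0ᴹ       = replicate n 0#
  ; -ᴹ_      = map -_
  ; isLeftModule = record
    { isLeftSemimodule = record
      { +ᴹ-isCommutativeMonoid = record
        { isMonoid = record
          { isSemigroup = record
            { isMagma = record
              { isEquivalence = isEquivalence
              ; ∙-cong = cong₂ (zipWith _+_)
              }
            ; assoc = zipWith-assoc R.+-assoc
            }
          ; identity = zipWith-identityˡ R.+-identityˡ
                     , zipWith-identityʳ R.+-identityʳ
          }
        ; comm = zipWith-comm R.+-comm
        }
      ; isPreleftSemimodule = record
        { *ₗ-cong      = cong₂ (λ a → map (a *_))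
        ; *ₗ-zeroˡ     = zeroˡ
        ; *ₗ-distribʳ  = distribʳ
        ; *ₗ-identityˡ = λ v → trans (map-cong R.*-identityˡ v) (map-id v)
        ; *ₗ-assoc     = λ a b v → trans (map-cong (R.*-assoc a b) v)
                                         (map-∘ (a *_) (b *_) v)
        ; *ₗ-zeroʳ     = λ a → trans (map-replicate (a *_) 0# n)
                                     (cong (replicate n) (R.zeroʳ a))
        ; *ₗ-distribˡ  = distribˡ
        }
      }
    ; -ᴹ‿cong    = cong (map -_)
    ; -ᴹ‿inverse = zipWith-inverseˡ R.-‿inverseˡ , zipWith-inverseʳ R.-‿inverseʳ
    }
  }
  where
  open Field F
  module R = CommutativeRing commutativeRing

  zeroˡ : ∀ {n} (v : Vec Carrier n) → map (0# *_) v ≡ replicate n 0#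
  zeroˡ []      = refl
  zeroˡ (x ∷ v) = cong₂ _∷_ (R.zeroˡ x) (zeroˡ v)

  distribʳ : ∀ {n} (v : Vec Carrier n) a b →
             map ((a + b) *_) v ≡ zipWith _+_ (map (a *_) v) (map (b *_) v)
  distribʳ []      a b = refl
  distribʳ (x ∷ v) a b = cong₂ _∷_ (R.distribʳ x a b) (distribʳ v a b)

  distribˡ : ∀ {n} a (v w : Vec Carrier n) →
             map (a *_) (zipWith _+_ v w) ≡ zipWith _+_ (map (a *_) v) (map (a *_) w)
  distribˡ a []      []      = refl
  distribˡ a (x ∷ v) (y ∷ w) = cong₂ _∷_ (R.distribˡ a x y) (distribˡ a v w)

restrictScalars : (K L : Field) {ι : Field.Carrier K → Field.Carrier L} →
                  IsRingHomomorphism (Field.rawRing K) (Field.rawRing L) ι →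
                  VectorSpace L → VectorSpace K
restrictScalars K L {ι} hom M = record
  { Carrierᴹ = Carrierᴹ
  ; _≈ᴹ_     = _≈ᴹ_
  ; _+ᴹ_     = _+ᴹ_
  ; _*ₗ_     = λ a v → ι a *ₗ v
  ; 0ᴹ       = 0ᴹ
  ; -ᴹ_      = -ᴹ_
  ; isLeftModule = record
    { isLeftSemimodule = record
      { +ᴹ-isCommutativeMonoid = +ᴹ-isCommutativeMonoid
      ; isPreleftSemimodule = record
        { *ₗ-cong      = λ a≡b → *ₗ-cong (cong ι a≡b)
        ; *ₗ-zeroˡ     = λ v → via 0#-homo v (*ₗ-zeroˡ v)
        ; *ₗ-distribʳ  = λ v a b → via (+-homo a b) v (*ₗ-distribʳ v (ι a) (ι b))
        ; *ₗ-identityˡ = λ v → via 1#-homo v (*ₗ-identityˡ v)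
        ; *ₗ-assoc     = λ a b v → via (*-homo a b) v (*ₗ-assoc (ι a) (ι b) v)
        ; *ₗ-zeroʳ     = λ a → *ₗ-zeroʳ (ι a)
        ; *ₗ-distribˡ  = λ a → *ₗ-distribˡ (ι a)
        }
      }
    ; -ᴹ‿cong    = -ᴹ‿cong
    ; -ᴹ‿inverse = -ᴹ‿inverse
    }
  }
  where
  open LeftModule M
  open IsRingHomomorphism hom

  via : ∀ {x y} → x ≡ y → ∀ v {w} → (y *ₗ v) ≈ᴹ w → (x *ₗ v) ≈ᴹ w
  via refl v eq = eq

record FiniteFieldExtension (q m : ℕ) : Set₁ where
  field
    𝔽q 𝔽qᵐ : Field
  module K = Field 𝔽q
  module L = Field 𝔽qᵐ
  field
    card-𝔽q            : K.Carrier ↔ Fin q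
    card-𝔽qᵐ           : L.Carrier ↔ Fin (q ℕ.^ m)
    ι                  : K.Carrier → L.Carrier
    isRingHomomorphism : IsRingHomomorphism K.rawRing L.rawRing ι

  restrict : VectorSpace 𝔽qᵐ → VectorSpace 𝔽q
  restrict = restrictScalars 𝔽q 𝔽qᵐ isRingHomomorphism

  module Kⁿ (n : ℕ) = LinearAlgebra 𝔽q (coordinateSpace 𝔽q n)
  module Lⁿ (n : ℕ) = LinearAlgebra 𝔽qᵐ (coordinateSpace 𝔽qᵐ n)
  module L/K = LinearAlgebra 𝔽q (restrict (tensorUnit {R = L.ring}))
  module Lⁿ/K (n : ℕ) = LinearAlgebra 𝔽q (restrict (coordinateSpace 𝔽qᵐ n))

  IsOrderedBasis : Vec L.Carrier m → Set
  IsOrderedBasis Γ = L/K.IsBasis Γ U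

module _ {q m : ℕ} (E : FiniteFieldExtension q m) where
  open FiniteFieldExtension E

  record IsCode {n : ℕ} (k : ℕ) (C : Pred (Vec L.Carrier n) 0ℓ) : Set where
    field
      isSubspace   : Lⁿ.IsSubspace n C
      hasDimension : Lⁿ.HasDimension n C k

  module RankSupport {Γ : Vec L.Carrier m} (isBasis : IsOrderedBasis Γ) where

    coordinates : L.Carrier → Vec K.Carrier m
    coordinates x = proj₁ (L/K.IsBasis.spanning isBasis {x} tt)

    -- Row i holds the coordinates of the i-th entry; the rank support is the
    -- span of the columns, hence the transpose in σʳᵏ.
    Γ⟨_⟩ : ∀ {n} → Vec L.Carrier n → Vec (Vec K.Carrier m) n
    Γ⟨ v ⟩ = map coordinates v

    σʳᵏ : ∀ {n} → Vec L.Carrier n → Pred (Vec K.Carrier n) 0ℓ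
    σʳᵏ {n} v = Kⁿ.Span n (transpose Γ⟨ v ⟩)

    Nondegenerate : ∀ {n} → Pred (Vec L.Carrier n) 0ℓ → Set
    Nondegenerate {n} C = Kⁿ.SumOfFamily n C σʳᵏ ≐ U

    Minimal : ∀ {n} → Pred (Vec L.Carrier n) 0ℓ → Set
    Minimal C = ∀ v v′ → v ∈ C → v′ ∈ C → σʳᵏ v′ ⊆ σʳᵏ v →
                ∃ λ α → v′ ≡ map (α L.*_) v

  IsGeneratorMatrix : ∀ {n k} → Vec (Vec L.Carrier n) k →
                      Pred (Vec L.Carrier n) 0ℓ → Set
  IsGeneratorMatrix {n} G C = Lⁿ.IsBasis n G C

  ColumnSystem : ∀ {n k} → Vec (Vec L.Carrier n) k → Pred (Vec L.Carrier k) 0ℓ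
  ColumnSystem {k = k} G = Lⁿ/K.Span k (transpose G)

  -- The index does not depend on the generator matrix, so fixing one
  -- existentially determines ℓ.
  IsLinearityIndex : ∀ {n} → ℕ → Pred (Vec L.Carrier n) 0ℓ → ℕ → Set₁
  IsLinearityIndex {n} k C ℓ =
    Σ (Vec (Vec L.Carrier n) k) λ G → IsGeneratorMatrix G C ×
      IsMaximum
        (λ d → Σ (Pred (Vec L.Carrier k) 0ℓ) λ H →
           Lⁿ.IsSubspace k H × Lⁿ.HasDimension k H d × H ⊆ ColumnSystem G)
        ℓ

  θ : ∀ {n} → Vec L.Carrier n → Vec L.Carrier n
  θ = map (L._^ q)

  θ⟦_⟧ : ∀ {n} → Pred (Vec L.Carrier n) 0ℓ → Pred (Vec L.Carrier n) 0ℓ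
  θ⟦ V ⟧ w = ∃ λ v → v ∈ V × θ v ≡ w

  Λ : (n : ℕ) → Pred (Pred (Vec L.Carrier n) 0ℓ) 0ℓ
  Λ n V = Lⁿ.IsSubspace n V × θ⟦ V ⟧ ≐ V

  IsGeneralizedRankWeight : ∀ {n} → ℕ → Pred (Vec L.Carrier n) 0ℓ → ℕ → Set₁
  IsGeneralizedRankWeight {n} r C =
    IsMinimum λ d → Σ (Pred (Vec L.Carrier n) 0ℓ) λ V →
      V ∈ Λ n × Lⁿ.HasDimension n V d ×
      (∃ λ s → Lⁿ.HasDimension n (V ∩ C) s × r ≤ s)

{-# OPTIONS --safe #-}

-- Let U ⊆ 𝔽qᵐᵏ be the column system of a generator matrix G. By
-- nondegeneracy y ↦ Gy is an isomorphism 𝔽qⁿ → U, and x · Gy = y · xG links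
-- hyperplane sections of U with the annihilators of codewords, that is, with
-- the orthogonals of their rank supports. The conditions are proved in a cycle.
--
-- (1) ⇒ (2): if U contains an 𝔽qᵐ-subspace W of dimension k − 2, then U/W has
-- only qᵐ elements, so one of the qᵐ + 1 hyperplanes through W meets U in W
-- only. The support of its codeword contains those of all codewords from W^⊥,
-- a two-dimensional family.
--
-- (2) ⇒ (3): a θ-stable space of dimension at most m is spanned by its rational
-- vectors. If it contains two independent codewords xG and x′G, counting shows
-- that the space ⟨x, x′⟩^⊥ of dimension k − 2 lies in U.
--
-- (3) ⇒ (1): if σ(v′) ⊆ σ(v), then the 𝔽qᵐ-span of σ(v) is θ-stable, has
-- dimension at most m and contains both v and v′.
module Submission where

open import Defs
open import Algebra.Bundles using (CommutativeRing; CommutativeMonoid)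
open import Algebra.Module.Bundles using (LeftModule)
open import Algebra.Module.Construct.TensorUnit using () renaming (leftModule to tensorUnit)
open import Algebra.Morphism.Structures using (IsRingHomomorphism)
import Algebra.Properties.CommutativeMonoid.Sum as Sum
import Algebra.Properties.CommutativeSemiring.Binomial as Binomial
import Algebra.Properties.CommutativeSemiring.Exp as CommutativeExp
import Algebra.Properties.Group as GroupProperties
import Algebra.Properties.Ring as RingProperties
import Algebra.Properties.Semiring.Exp as SemiringExp
import Algebra.Properties.Semiring.Mult as SemiringMult
open import Data.Empty using (⊥)
open import Data.Fin.Base using (Fin; zero; suc; inject₁; fromℕ; punchIn)
open import Data.Fin.Properties as Fin
  using (injective⇒≤; *↔×; toℕ<n; toℕ-inject₁; toℕ-fromℕ; punchInᵢ≢i; ¬∀⟶∃¬)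
open import Data.List.Base using ([]; _∷_)
open import Data.List.Relation.Unary.All using ([]; _∷_)
open import Data.Nat.Base as ℕ using (ℕ; zero; suc; _≤_; _<_; _!; s≤s; z≤n)
import Data.Nat.Combinatorics as ℕ
open import Data.Nat.Combinatorics using (nCn≡1)
open import Data.Nat.Combinatorics.Specification using (nCk≡n!/k![n-k]!; [n∸k]!k!∣n!)
open import Data.Nat.DivMod using (m/n*n≡m)
open import Data.Nat.Divisibility using (_∣_; divides; m∣m*n; ∣⇒≤; ∣1⇒≡1)
open import Data.Nat.Primality using (Prime; prime⇒nonZero; euclidsLemma; ¬prime[1])
open import Data.Nat.Properties as ℕ using (_!≢0)
open import Data.Product.Base using (Σ; ∃; ∃₂; _×_; _,_; proj₁; proj₂)
open import Data.Product.Function.NonDependent.Propositional using (_×-↔_)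
open import Data.Sum.Base using (_⊎_; inj₁; inj₂; [_,_]′)
open import Data.Unit.Base using (tt)
open import Data.Vec.Base
  using (Vec; []; _∷_; map; zipWith; replicate; transpose; lookup; head; tail; _⊛_)
open import Data.Vec.Properties
  using (∷-injective; ≡-dec; map-replicate; map-cong; map-∘; map-id; lookup-map; lookup-zipWith)
open import Data.Vec.Relation.Unary.All as AllVec using ([]; _∷_) renaming (All to AllVec)
open import Data.Vec.Relation.Unary.All.Properties using (map⁺)
open import Function.Base using (_∘_; id)
open import Function.Bundles using (_↔_; mk↔ₛ′; Inverse; _⇔_; mk⇔)
open import Function.Construct.Composition using (_↔-∘_)
open import Function.Construct.Identity using (↔-id)
open import Function.Construct.Symmetry using (↔-sym)
open import Function.Definitions using (Injective)
open import Level using (0ℓ)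
open import Relation.Binary.Definitions using (DecidableEquality)
open import Relation.Binary.PropositionalEquality
open import Relation.Nullary using (Dec; yes; no; ¬_; contradiction)
open import Relation.Nullary.Decidable using (map′; decidable-stable; _×-dec_; ¬?)
open import Relation.Unary using (Pred; _∈_; _⊆_; Decidable; _∩_)

-- Finite sets

module Finite {A : Set} {N : ℕ} (card : A ↔ Fin N) where
  open Inverse card

  to-injective : Injective _≡_ _≡_ to
  to-injective {x} {y} eq =
    trans (sym (strictlyInverseʳ x)) (trans (cong from eq) (strictlyInverseʳ y))

  infix 4 _≟_
  _≟_ : DecidableEquality A
  x ≟ y = map′ to-injective (cong to) (to x Fin.≟ to y)

  any? : ∀ {ℓ} {P : Pred A ℓ} → Decidable P → Dec (∃ P)
  any? {P = P} P? = map′ (λ (i , p) → from i , p)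
    (λ (a , p) → to a , subst P (sym (strictlyInverseʳ a)) p) (Fin.any? (P? ∘ from))

from-injective : ∀ {A : Set} {N : ℕ} (card : A ↔ Fin N) → Injective _≡_ _≡_ (Inverse.from card)
from-injective card {x} {y} eq =
  trans (sym (strictlyInverseˡ x)) (trans (cong to eq) (strictlyInverseˡ y))
  where open Inverse card

injection⇒≤ : ∀ {A B : Set} {a b} → A ↔ Fin a → B ↔ Fin b →
              (f : A → B) → Injective _≡_ _≡_ f → a ≤ b
injection⇒≤ A↔ B↔ f f-inj = injective⇒≤ {f = Inverse.to B↔ ∘ f ∘ Inverse.from A↔}
  (from-injective A↔ ∘ f-inj ∘ Finite.to-injective B↔)

×-card : ∀ {A B : Set} {a b} → A ↔ Fin a → B ↔ Fin b → (A × B) ↔ Fin (a ℕ.* b)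
×-card A↔ B↔ = ↔-sym *↔× ↔-∘ (A↔ ×-↔ B↔)

Vec-card : ∀ {A : Set} {N} → A ↔ Fin N → ∀ n → Vec A n ↔ Fin (N ℕ.^ n)
Vec-card card zero    = mk↔ₛ′ (λ _ → zero) (λ _ → []) (λ { zero → refl }) λ { [] → refl }
Vec-card card (suc n) = ×-card card (Vec-card card n) ↔-∘
  mk↔ₛ′ (λ v → head v , tail v) (λ (x , v) → x ∷ v) (λ _ → refl) λ { (x ∷ v) → refl }

-- Linear maps and linear combinations

module _ (F : Field) where

  record IsLinear (M N : VectorSpace F)
                  (f : LeftModule.Carrierᴹ M → LeftModule.Carrierᴹ N) : Set where
    private
      module M = LeftModule M
      module N = LeftModule N
    field
      cong-≈ : ∀ {u v} → u M.≈ᴹ v → f u N.≈ᴹ f v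
      homo-+ : ∀ u v → f (u M.+ᴹ v) N.≈ᴹ f u N.+ᴹ f v
      homo-* : ∀ a v → f (a M.*ₗ v) N.≈ᴹ a N.*ₗ f v

    homo-0 : f M.0ᴹ N.≈ᴹ N.0ᴹ
    homo-0 = N.≈ᴹ-trans (cong-≈ (M.≈ᴹ-sym (M.*ₗ-zeroˡ M.0ᴹ)))
      (N.≈ᴹ-trans (homo-* _ M.0ᴹ) (N.*ₗ-zeroˡ (f M.0ᴹ)))

module Difference (F : Field) (M : VectorSpace F) where
  open Field F using (1#; -_; commutativeRing)
  module R = CommutativeRing commutativeRing
  open LeftModule M renaming (Carrierᴹ to V)
  open import Relation.Binary.Reasoning.Setoid ≈ᴹ-setoid

  infixl 6 _⊖_
  _⊖_ : V → V → V
  u ⊖ v = u +ᴹ (- 1#) *ₗ v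

  private
    cancel : ∀ v → (- 1#) *ₗ v +ᴹ v ≈ᴹ 0ᴹ
    cancel v = begin
      (- 1#) *ₗ v +ᴹ v         ≈⟨ +ᴹ-cong ≈ᴹ-refl (*ₗ-identityˡ v) ⟨
      (- 1#) *ₗ v +ᴹ 1# *ₗ v   ≈⟨ *ₗ-distribʳ v _ _ ⟨
      (R._+_ (- 1#) 1#) *ₗ v   ≈⟨ *ₗ-cong (R.-‿inverseˡ 1#) ≈ᴹ-refl ⟩
      R.0# *ₗ v                ≈⟨ *ₗ-zeroˡ v ⟩
      0ᴹ ∎

  ⊖-+ : ∀ u v → u ⊖ v +ᴹ v ≈ᴹ u
  ⊖-+ u v = begin
    u ⊖ v +ᴹ v               ≈⟨ +ᴹ-assoc _ _ _ ⟩
    u +ᴹ ((- 1#) *ₗ v +ᴹ v)  ≈⟨ +ᴹ-cong ≈ᴹ-refl (cancel v) ⟩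
    u +ᴹ 0ᴹ                  ≈⟨ +ᴹ-identityʳ u ⟩
    u ∎

  ⊖≈0⇒≈ : ∀ {u v} → u ⊖ v ≈ᴹ 0ᴹ → u ≈ᴹ v
  ⊖≈0⇒≈ {u} {v} eq = begin
    u            ≈⟨ ⊖-+ u v ⟨
    u ⊖ v +ᴹ v   ≈⟨ +ᴹ-cong eq ≈ᴹ-refl ⟩
    0ᴹ +ᴹ v      ≈⟨ +ᴹ-identityˡ v ⟩
    v ∎

  ≈⇒⊖≈0 : ∀ {u v} → u ≈ᴹ v → u ⊖ v ≈ᴹ 0ᴹ
  ≈⇒⊖≈0 {u} {v} eq = begin
    u +ᴹ (- 1#) *ₗ v   ≈⟨ +ᴹ-cong eq ≈ᴹ-refl ⟩
    v +ᴹ (- 1#) *ₗ v   ≈⟨ +ᴹ-comm _ _ ⟩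
    (- 1#) *ₗ v +ᴹ v   ≈⟨ cancel v ⟩
    0ᴹ ∎

module _ (F : Field) {M N : VectorSpace F}
         {f : LeftModule.Carrierᴹ M → LeftModule.Carrierᴹ N} (linear : IsLinear F M N f) where
  open IsLinear linear
  private
    module N = LeftModule N

  homo-⊖ : ∀ u v → f (Difference._⊖_ F M u v) N.≈ᴹ Difference._⊖_ F N (f u) (f v)
  homo-⊖ u v = N.≈ᴹ-trans (homo-+ u _) (N.+ᴹ-cong N.≈ᴹ-refl (homo-* _ v))

  lc-homo : ∀ {d} (c : Vec (Field.Carrier F) d) b →
            f (LinearAlgebra.linearCombination F M c b) N.≈ᴹ
            LinearAlgebra.linearCombination F N c (map f b)
  lc-homo []      []      = homo-0
  lc-homo (a ∷ c) (v ∷ b) = N.≈ᴹ-trans (homo-+ _ _) (N.+ᴹ-cong (homo-* a v) (lc-homo c b))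

module Combinations (F : Field) (M : VectorSpace F) where
  open Field F using (Carrier; 0#; 1#; _+_; _*_; -_; commutativeRing)
  private
    module R = CommutativeRing commutativeRing
  open LeftModule M renaming (Carrierᴹ to V)
  open LinearAlgebra F M
  open Difference F M using (_⊖_; ≈⇒⊖≈0)
  open import Relation.Binary.Reasoning.Setoid ≈ᴹ-setoid

  +ᴹ-interchange : ∀ u v w x → (u +ᴹ v) +ᴹ (w +ᴹ x) ≈ᴹ (u +ᴹ w) +ᴹ (v +ᴹ x)
  +ᴹ-interchange u v w x = begin
    (u +ᴹ v) +ᴹ (w +ᴹ x)   ≈⟨ +ᴹ-assoc _ _ _ ⟩
    u +ᴹ (v +ᴹ (w +ᴹ x))   ≈⟨ +ᴹ-cong ≈ᴹ-refl (+ᴹ-assoc _ _ _) ⟨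
    u +ᴹ ((v +ᴹ w) +ᴹ x)   ≈⟨ +ᴹ-cong ≈ᴹ-refl (+ᴹ-cong (+ᴹ-comm v w) ≈ᴹ-refl) ⟩
    u +ᴹ ((w +ᴹ v) +ᴹ x)   ≈⟨ +ᴹ-cong ≈ᴹ-refl (+ᴹ-assoc _ _ _) ⟩
    u +ᴹ (w +ᴹ (v +ᴹ x))   ≈⟨ +ᴹ-assoc _ _ _ ⟨
    (u +ᴹ w) +ᴹ (v +ᴹ x) ∎

  lc-linear : ∀ {d} (b : Vec V d) → IsLinear F (coordinateSpace F d) M (λ c → linearCombination c b)
  lc-linear b = record
    { cong-≈ = λ { refl → ≈ᴹ-refl } ; homo-+ = λ c c′ → plus c c′ b ; homo-* = λ a c → scale a c b }
    where
    plus : ∀ {d} c c′ (b : Vec V d) →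
           linearCombination (zipWith _+_ c c′) b ≈ᴹ linearCombination c b +ᴹ linearCombination c′ b
    plus []      []        []      = ≈ᴹ-sym (+ᴹ-identityˡ 0ᴹ)
    plus (x ∷ c) (x′ ∷ c′) (v ∷ b) = ≈ᴹ-trans
      (+ᴹ-cong (*ₗ-distribʳ v x x′) (plus c c′ b)) (+ᴹ-interchange _ _ _ _)

    scale : ∀ {d} a c (b : Vec V d) →
            linearCombination (map (a *_) c) b ≈ᴹ a *ₗ linearCombination c b
    scale a []      []      = ≈ᴹ-sym (*ₗ-zeroʳ a)
    scale a (x ∷ c) (v ∷ b) = ≈ᴹ-trans
      (+ᴹ-cong (*ₗ-assoc a x v) (scale a c b)) (≈ᴹ-sym (*ₗ-distribˡ a _ _))

  module _ {d : ℕ} (b : Vec V d) where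
    open IsLinear (lc-linear b) public
      renaming (homo-+ to lc-+; homo-* to lc-*; homo-0 to lc-0) using ()

    independent⇒injective : LinearlyIndependent b → ∀ c c′ →
                            linearCombination c b ≈ᴹ linearCombination c′ b → c ≡ c′
    independent⇒injective indep c c′ eq = Difference.⊖≈0⇒≈ F (coordinateSpace F d)
      (indep _ (≈ᴹ-trans (homo-⊖ F (lc-linear b) c c′) (≈⇒⊖≈0 eq)))

    span-isSubspace : IsSubspace (Span b)
    span-isSubspace = record
      { ≈ᴹ-closed = λ { eq (c , p) → c , ≈ᴹ-trans p eq }
      ; 0ᴹ-closed = replicate d 0# , lc-0
      ; +ᴹ-closed = λ { (c , p) (c′ , p′) → zipWith _+_ c c′ , ≈ᴹ-trans (lc-+ c c′) (+ᴹ-cong p p′) }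
      ; *ₗ-closed = λ { a (c , p) → map (a *_) c , ≈ᴹ-trans (lc-* a c) (*ₗ-cong R.refl p) }
      }

  lc∈ : ∀ {P} → IsSubspace P → ∀ {d} c {b : Vec V d} → AllVec P b → linearCombination c b ∈ P
  lc∈ isSub []      []       = IsSubspace.0ᴹ-closed isSub
  lc∈ isSub (x ∷ c) (v ∷ vs) =
    IsSubspace.+ᴹ-closed isSub (IsSubspace.*ₗ-closed isSub x v) (lc∈ isSub c vs)

  span⊆ : ∀ {P} → IsSubspace P → ∀ {d} {b : Vec V d} → AllVec P b → Span b ⊆ P
  span⊆ isSub ps (c , eq) = IsSubspace.≈ᴹ-closed isSub eq (lc∈ isSub c ps)

  ⊖-closed : ∀ {P} → IsSubspace P → ∀ {u v} → u ∈ P → v ∈ P → (u ⊖ v) ∈ P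
  ⊖-closed isSub p q = IsSubspace.+ᴹ-closed isSub p (IsSubspace.*ₗ-closed isSub _ q)

  skip : ∀ {d} c x {v} {b : Vec V d} → x ≡ 0# → linearCombination (x ∷ c) (v ∷ b) ≈ᴹ linearCombination c b
  skip c x {v} refl = ≈ᴹ-trans (+ᴹ-cong (*ₗ-zeroˡ v) ≈ᴹ-refl) (+ᴹ-identityˡ _)

  span-∷ : ∀ {d} {v} {b : Vec V d} → Span b ⊆ Span (v ∷ b)
  span-∷ (c , eq) = 0# ∷ c , ≈ᴹ-trans (skip c 0# refl) eq

  head∈span : ∀ {d} {v} {b : Vec V d} → v ∈ Span (v ∷ b)
  head∈span {v = v} {b} = 1# ∷ replicate _ 0# ,
    ≈ᴹ-trans (+ᴹ-cong (*ₗ-identityˡ v) (lc-0 b)) (+ᴹ-identityʳ v)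

  members∈span : ∀ {d} (b : Vec V d) → AllVec (Span b) b
  members∈span []      = []
  members∈span (v ∷ b) = head∈span ∷ AllVec.map span-∷ (members∈span b)

  independent-tail : ∀ {d v} {b : Vec V d} → LinearlyIndependent (v ∷ b) → LinearlyIndependent b
  independent-tail indep c eq = proj₂ (∷-injective (indep (0# ∷ c) (≈ᴹ-trans (skip c 0# refl) eq)))

  independent-drop : ∀ {P : Pred V 0ℓ} r {d} (b : Vec V (r ℕ.+ d)) → AllVec P b → LinearlyIndependent b →
                     ∃ λ (b′ : Vec V d) → AllVec P b′ × LinearlyIndependent b′
  independent-drop zero    b       ps       indep = b , ps , indep
  independent-drop (suc r) (v ∷ b) (p ∷ ps) indep =
    independent-drop r b ps (independent-tail indep)

  inverse-scale : ∀ {x y u v} → x * y ≡ 1# → x *ₗ u ≈ᴹ v → u ≈ᴹ y *ₗ v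
  inverse-scale {x} {y} {u} {v} xy eq = begin
    u              ≈⟨ *ₗ-identityˡ u ⟨
    1# *ₗ u        ≈⟨ *ₗ-cong (R.trans (R.*-comm y x) xy) ≈ᴹ-refl ⟨
    (y * x) *ₗ u   ≈⟨ *ₗ-assoc y x u ⟩
    y *ₗ (x *ₗ u)  ≈⟨ *ₗ-cong R.refl eq ⟩
    y *ₗ v ∎

  -ᴹ-unique : ∀ {u v} → u +ᴹ v ≈ᴹ 0ᴹ → u ≈ᴹ (- 1#) *ₗ v
  -ᴹ-unique {u} {v} eq = begin
    u                            ≈⟨ +ᴹ-identityʳ u ⟨
    u +ᴹ 0ᴹ                      ≈⟨ +ᴹ-cong ≈ᴹ-refl (≈⇒⊖≈0 ≈ᴹ-refl) ⟨
    u +ᴹ (v +ᴹ (- 1#) *ₗ v)      ≈⟨ +ᴹ-assoc _ _ _ ⟨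
    (u +ᴹ v) +ᴹ (- 1#) *ₗ v      ≈⟨ +ᴹ-cong eq ≈ᴹ-refl ⟩
    0ᴹ +ᴹ (- 1#) *ₗ v            ≈⟨ +ᴹ-identityˡ _ ⟩
    (- 1#) *ₗ v ∎

  independent-∷ : DecidableEquality Carrier → ∀ {d v} {b : Vec V d} →
                  LinearlyIndependent b → ¬ v ∈ Span b → LinearlyIndependent (v ∷ b)
  independent-∷ _≟_ {v = v} {b} indep v∉ (x ∷ c) eq with x ≟ 0#
  ... | yes refl = cong (0# ∷_) (indep c (≈ᴹ-trans (≈ᴹ-sym (skip c 0# refl)) eq))
  ... | no x≢0   = contradiction
    (≈ᴹ-closed (≈ᴹ-sym (inverse-scale (proj₂ (Field.inverse F x x≢0)) (-ᴹ-unique eq)))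
      (*ₗ-closed _ (*ₗ-closed _ (c , ≈ᴹ-refl)))) v∉
    where open IsSubspace (span-isSubspace b)

  head∉span : ∀ {d v} {b : Vec V d} → LinearlyIndependent (v ∷ b) → ¬ v ∈ Span b
  head∉span {v = v} {b} indep (c , eq) = Field.0≢1 F (sym (proj₁ (∷-injective
    (independent⇒injective (v ∷ b) indep (1# ∷ replicate _ 0#) (0# ∷ c)
      (≈ᴹ-trans (proj₂ (head∈span {b = b})) (≈ᴹ-sym (≈ᴹ-trans (skip c 0# refl) eq)))))))

^-cancelʳ-≤ : ∀ {N a b} → 1 < N → N ℕ.^ a ≤ N ℕ.^ b → a ≤ b
^-cancelʳ-≤ {N} 1<N le = ℕ.≮⇒≥ λ b<a → ℕ.<⇒≱ (ℕ.^-monoʳ-< N 1<N b<a) le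

module _ (F : Field) {M N : VectorSpace F}
         {f : LeftModule.Carrierᴹ M → LeftModule.Carrierᴹ N} (linear : IsLinear F M N f) where
  open IsLinear linear
  private
    module M = LeftModule M
    module N = LeftModule N

  Kernel : Pred M.Carrierᴹ 0ℓ
  Kernel v = f v N.≈ᴹ N.0ᴹ

  kernel-isSubspace : LinearAlgebra.IsSubspace F M Kernel
  kernel-isSubspace = record
    { ≈ᴹ-closed = λ eq p → N.≈ᴹ-trans (cong-≈ (M.≈ᴹ-sym eq)) p
    ; 0ᴹ-closed = homo-0
    ; +ᴹ-closed = λ p q → N.≈ᴹ-trans (homo-+ _ _) (N.≈ᴹ-trans (N.+ᴹ-cong p q) (N.+ᴹ-identityˡ _))
    ; *ₗ-closed = λ a p → N.≈ᴹ-trans (homo-* a _) (N.≈ᴹ-trans (N.*ₗ-cong refl p) (N.*ₗ-zeroʳ a))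
    }

-- Linear algebra over a finite field

module DotProduct (F : Field) where
  open Field F
  private
    module R = CommutativeRing commutativeRing
    module Sp (n : ℕ) = LinearAlgebra F (coordinateSpace F n)

  scalars : VectorSpace F
  scalars = tensorUnit {R = ring}

  infix 8 _·_
  _·_ : ∀ {n} → Vec Carrier n → Vec Carrier n → Carrier
  _·_ = LinearAlgebra.linearCombination F scalars

  ·-comm : ∀ {n} (v w : Vec Carrier n) → v · w ≡ w · v
  ·-comm []      []      = refl
  ·-comm (x ∷ v) (y ∷ w) = cong₂ _+_ (R.*-comm x y) (·-comm v w)

  ·-linearˡ : ∀ {n} (w : Vec Carrier n) → IsLinear F (coordinateSpace F n) scalars (_· w)
  ·-linearˡ = Combinations.lc-linear F scalars

  ·-linearʳ : ∀ {n} (v : Vec Carrier n) → IsLinear F (coordinateSpace F n) scalars (v ·_)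
  ·-linearʳ v = record
    { cong-≈ = cong (v ·_)
    ; homo-+ = λ u w → trans (·-comm v _) (trans (L.homo-+ u w) (cong₂ _+_ (·-comm u v) (·-comm w v)))
    ; homo-* = λ a w → trans (·-comm v _) (trans (L.homo-* a w) (cong (a *_) (·-comm w v)))
    }
    where module L = IsLinear (·-linearˡ v)

  ·-lc : ∀ {n d} (v : Vec Carrier n) (c : Vec Carrier d) b →
         v · Sp.linearCombination n c b ≡ c · map (v ·_) b
  ·-lc v = lc-homo F (·-linearʳ v)

  lc-transpose : ∀ {n d} (y : Vec Carrier n) (b : Vec (Vec Carrier n) d) →
                 Sp.linearCombination d y (transpose b) ≡ map (y ·_) b
  lc-transpose y []      = empty y
    where
    empty : ∀ {n} (y : Vec Carrier n) → Sp.linearCombination 0 y (replicate n []) ≡ []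
    empty []      = refl
    empty (x ∷ y) = cong (zipWith _+_ []) (empty y)
  lc-transpose y (v ∷ b) = trans (cons y v (transpose b)) (cong (y · v ∷_) (lc-transpose y b))
    where
    cons : ∀ {n d} (y v : Vec Carrier n) (B : Vec (Vec Carrier d) n) →
           Sp.linearCombination (suc d) y ((replicate n _∷_ ⊛ v) ⊛ B) ≡
           y · v ∷ Sp.linearCombination d y B
    cons []      []      []      = refl
    cons (a ∷ y) (x ∷ v) (w ∷ B) = cong (zipWith _+_ (map (a *_) (x ∷ w))) (cons y v B)

  dots-linear : ∀ {n d} (b : Vec (Vec Carrier n) d) →
                IsLinear F (coordinateSpace F n) (coordinateSpace F d) (λ y → map (y ·_) b)
  dots-linear b = record
    { cong-≈ = cong _
    ; homo-+ = λ u v → trans (sym (lc-transpose (zipWith _+_ u v) b))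
        (trans (L.homo-+ u v) (cong₂ (zipWith _+_) (lc-transpose u b) (lc-transpose v b)))
    ; homo-* = λ a v → trans (sym (lc-transpose (map (a *_) v) b))
        (trans (L.homo-* a v) (cong (map (a *_)) (lc-transpose v b)))
    }
    where module L = IsLinear (Combinations.lc-linear F (coordinateSpace F _) (transpose b))

  Perp : ∀ {n d} → Vec (Vec Carrier n) d → Pred (Vec Carrier n) 0ℓ
  Perp b = Kernel F (dots-linear b)

  perp-isSubspace : ∀ {n d} (b : Vec (Vec Carrier n) d) → Sp.IsSubspace n (Perp b)
  perp-isSubspace b = kernel-isSubspace F (dots-linear b)

  perp-span : ∀ {n d} {b : Vec (Vec Carrier n) d} {y w} → y ∈ Perp b → w ∈ Sp.Span n b → y · w ≡ 0#
  perp-span {b = b} {y} p (c , refl) =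
    trans (·-lc y c b) (trans (cong (c ·_) p) (IsLinear.homo-0 (·-linearʳ c)))

module FiniteLinearAlgebra (F : Field) {N : ℕ} (card : Field.Carrier F ↔ Fin N) where
  open Field F
  open DotProduct F
  private
    module R = CommutativeRing commutativeRing
    module Sp {n : ℕ} = LinearAlgebra F (coordinateSpace F n)
    module C {n : ℕ} = Combinations F (coordinateSpace F n)
    module D {n : ℕ} = Difference F (coordinateSpace F n)
  open Sp
  open C
  open D using (_⊖_; ⊖-+; ⊖≈0⇒≈; ≈⇒⊖≈0)

  open Finite card public using (_≟_)

  infix 4 _≟ᵛ_
  _≟ᵛ_ : ∀ {n} → DecidableEquality (Vec Carrier n)
  _≟ᵛ_ = ≡-dec _≟_

  module _ {n : ℕ} where
    open Finite (Vec-card card n) public using () renaming (any? to anyᵛ?)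

  1<card : 1 < N
  1<card = injective⇒≤ {f = λ i → Inverse.to card (two i)} λ {i} {j} eq →
    two-injective i j (Finite.to-injective card eq)
    where
    two : Fin 2 → Carrier
    two zero       = 0#
    two (suc zero) = 1#

    two-injective : ∀ i j → two i ≡ two j → i ≡ j
    two-injective zero       zero       eq = refl
    two-injective zero       (suc zero) eq = contradiction eq 0≢1
    two-injective (suc zero) zero       eq = contradiction (sym eq) 0≢1
    two-injective (suc zero) (suc zero) eq = refl

  module _ (M : VectorSpace F) where
    open LeftModule M
    private
      module M = LinearAlgebra F M

    independent-count : ∀ {s} {b : Vec Carrierᴹ s} → M.LinearlyIndependent b →
      ∀ {Y : Set} {y} → Y ↔ Fin y → (g : Y → Carrierᴹ) →
      (∀ c → ∃ λ i → g i ≈ᴹ M.linearCombination c b) → N ℕ.^ s ≤ y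
    independent-count {s} {b} indep Y↔ g cover = injection⇒≤ (Vec-card card s) Y↔ (proj₁ ∘ cover)
      λ {c} {c′} eq → Combinations.independent⇒injective F M b indep c c′
        (≈ᴹ-trans (≈ᴹ-sym (proj₂ (cover c)))
          (≈ᴹ-trans (≈ᴹ-reflexive (cong g eq)) (proj₂ (cover c′))))

  dimension-≤ : ∀ {n r d} {a : Vec (Vec Carrier n) r} {b : Vec (Vec Carrier n) d} →
                LinearlyIndependent a → AllVec (Span b) a → r ≤ d
  dimension-≤ {n} {d = d} {a} {b} indep a∈ = ^-cancelʳ-≤ 1<card
    (independent-count (coordinateSpace F n) indep (Vec-card card d) (λ c → linearCombination c b)
      λ c → lc∈ (span-isSubspace b) c a∈)

  span? : ∀ {n d} (b : Vec (Vec Carrier n) d) → Decidable (Span b)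
  span? b v = anyᵛ? λ c → linearCombination c b ≟ᵛ v

  basis-exists : ∀ {n} {P : Pred (Vec Carrier n) 0ℓ} → Decidable P → ∃ (HasDimension P)
  basis-exists {n} {P} P? with sieve (Inverse.from (Vec-card card n))
    where
    sieve : ∀ {e} (f : Fin e → Vec Carrier n) → ∃₂ λ d (b : Vec _ d) →
            AllVec P b × LinearlyIndependent b × (∀ i → f i ∈ P → f i ∈ Span b)
    sieve {zero}  f = 0 , [] , [] , (λ { [] _ → refl }) , λ ()
    sieve {suc e} f with sieve (f ∘ suc)
    ... | d , b , b∈ , indep , cover with P? (f zero) | span? b (f zero)
    ...   | no ¬p | _      = d , b , b∈ , indep , λ { zero p → contradiction p ¬p ; (suc i) → cover i }
    ...   | yes _ | yes s  = d , b , b∈ , indep , λ { zero _ → s ; (suc i) → cover i }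
    ...   | yes p | no ¬s  = suc d , f zero ∷ b , p ∷ b∈ , independent-∷ _≟_ indep ¬s ,
      λ { zero _ → head∈span ; (suc i) q → span-∷ (cover i q) }
  ... | d , b , b∈ , indep , cover = d , b , record
    { members = b∈ ; independent = indep
    ; spanning = λ {v} p → subst (_∈ Span b) (inv v) (cover _ (subst P (sym (inv v)) p)) }
    where
    inv = Inverse.strictlyInverseʳ (Vec-card card n)

  subspace? : ∀ {n d} {P : Pred (Vec Carrier n) 0ℓ} → IsSubspace P → HasDimension P d → Decidable P
  subspace? isSub (b , isBasis) v =
    map′ (span⊆ isSub (IsBasis.members isBasis)) (IsBasis.spanning isBasis) (span? b v)

  zero-or-dual : ∀ {n} (w : Vec Carrier n) → w ≡ replicate n 0# ⊎ ∃ λ y → y · w ≡ 1#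
  zero-or-dual []      = inj₁ refl
  zero-or-dual (x ∷ w) with x ≟ 0#
  ... | no x≢0 = inj₂ (y ∷ replicate _ 0# , trans
          (cong₂ _+_ (trans (R.*-comm y x) xy) (IsLinear.homo-0 (·-linearˡ w))) (R.+-identityʳ 1#))
    where
    y = proj₁ (inverse x x≢0)
    xy = proj₂ (inverse x x≢0)
  ... | yes refl with zero-or-dual w
  ...   | inj₁ eq = inj₁ (cong (0# ∷_) eq)
  ...   | inj₂ (y , eq) = inj₂ (0# ∷ y , trans (cong₂ _+_ (R.zeroˡ 0#) eq) (R.+-identityˡ 1#))

  separate : ∀ {n d} (b : Vec (Vec Carrier n) d) w → w ∈ Span b ⊎ ∃ λ y → y ∈ Perp b × y · w ≡ 1#
  separate []      w with zero-or-dual w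
  ... | inj₁ eq       = inj₁ ([] , sym eq)
  ... | inj₂ (y , eq) = inj₂ (y , refl , eq)
  separate {n} (v ∷ b) w with separate b w
  ... | inj₁ p = inj₁ (span-∷ p)
  ... | inj₂ (y , y⊥b , yw) with y · v ≟ 0#
  ...   | yes yv = inj₂ (y , cong₂ _∷_ yv y⊥b , yw)
  ...   | no yv≢0 with inverse _ yv≢0
  ...     | s , yvs with separate b (w ⊖ map (s *_) v)
  ...       | inj₁ p = inj₁ (subst (_∈ Span (v ∷ b)) (⊖-+ w _)
                (+ᴹ-closed (span-∷ p) (*ₗ-closed s (head∈span {b = b}))))
    where open IsSubspace (span-isSubspace (v ∷ b))
  ...       | inj₂ (z , z⊥b , zw) =
    inj₂ (x , cong₂ _∷_ xv (⊖-closed (perp-isSubspace b) {z} {map (t *_) y} z⊥b (*ₗ-closed t {y} y⊥b)) , xw)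
    where
    open ≡-Reasoning
    open IsSubspace (perp-isSubspace b)
    open Difference F scalars using () renaming (_⊖_ to _⊟_; ≈⇒⊖≈0 to ⊟-self)
    t x : _
    t = z · v * s
    x = z ⊖ map (t *_) y

    x· : ∀ u → x · u ≡ z · u ⊟ t * (y · u)
    x· u = trans (homo-⊖ F (·-linearˡ u) z _) (cong ((z · u) ⊟_) (IsLinear.homo-* (·-linearˡ u) t y))

    xv : x · v ≡ 0#
    xv = trans (x· v) (⊟-self (sym (begin
      z · v * s * (y · v)    ≡⟨ R.*-assoc _ s _ ⟩
      z · v * (s * (y · v))  ≡⟨ cong ((z · v) *_) (trans (R.*-comm s _) yvs) ⟩
      z · v * 1#             ≡⟨ R.*-identityʳ _ ⟩
      z · v ∎)))

    xw : x · w ≡ 1#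
    xw = begin
      x · w                    ≡⟨ x· w ⟩
      z · w ⊟ t * (y · w)      ≡⟨ cong (λ e → z · w ⊟ t * e) yw ⟩
      z · w ⊟ t * 1#           ≡⟨ cong ((z · w) ⊟_) (trans (R.*-identityʳ t) (R.*-comm _ s)) ⟩
      z · w ⊟ s * (z · v)      ≡⟨ cong ((z · w) ⊟_) (IsLinear.homo-* (·-linearʳ z) s v) ⟨
      z · w ⊟ z · map (s *_) v ≡⟨ homo-⊖ F (·-linearʳ z) w _ ⟨
      z · (w ⊖ map (s *_) v)   ≡⟨ zw ⟩
      1# ∎

  perp-perp⊆span : ∀ {n d} (b : Vec (Vec Carrier n) d) {w} →
                   (∀ y → y ∈ Perp b → y · w ≡ 0#) → w ∈ Span b
  perp-perp⊆span b {w} h with separate b w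
  ... | inj₁ p = p
  ... | inj₂ (y , y⊥b , yw) = contradiction (trans (sym (h y y⊥b)) yw) 0≢1

  orthogonal-to-all⇒0 : ∀ {n} {w : Vec Carrier n} → (∀ y → y · w ≡ 0#) → w ≡ replicate n 0#
  orthogonal-to-all⇒0 {w = w} h with zero-or-dual w
  ... | inj₁ eq = eq
  ... | inj₂ (y , yw) = contradiction (trans (sym (h y)) yw) 0≢1

  interpolate : ∀ {n d} (b : Vec (Vec Carrier n) d) → LinearlyIndependent b →
                ∀ t → ∃ λ y → map (y ·_) b ≡ t
  interpolate         []      indep []       = replicate _ 0# , refl
  interpolate {n} (v ∷ b) indep (t ∷ ts) with separate b v
  ... | inj₁ v∈ = contradiction v∈ (head∉span indep)
  ... | inj₂ (z , z⊥b , zv) with interpolate b (independent-tail indep) ts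
  ...   | y , yb = x , cong₂ _∷_ xv xb
    where
    open ≡-Reasoning
    open Difference F scalars using () renaming (_⊖_ to _⊟_; ⊖-+ to ⊟-+)
    a x : _
    a = t ⊟ y · v
    x = zipWith _+_ y (map (a *_) z)

    xv : x · v ≡ t
    xv = begin
      x · v                  ≡⟨ IsLinear.homo-+ (·-linearˡ v) y _ ⟩
      y · v + map (a *_) z · v ≡⟨ cong ((y · v) +_) (IsLinear.homo-* (·-linearˡ v) a z) ⟩
      y · v + a * (z · v)    ≡⟨ cong (λ e → y · v + a * e) zv ⟩
      y · v + a * 1#         ≡⟨ trans (R.+-comm _ _) (cong (_+ (y · v)) (R.*-identityʳ a)) ⟩
      a + y · v              ≡⟨ ⊟-+ t (y · v) ⟩
      t ∎

    module S {n} = LeftModule (coordinateSpace F n)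

    xb : map (x ·_) b ≡ ts
    xb = begin
      map (x ·_) b ≡⟨ IsLinear.homo-+ (dots-linear b) y _ ⟩
      map (y ·_) b S.+ᴹ map (map (a *_) z ·_) b
        ≡⟨ cong₂ S._+ᴹ_ yb (IsSubspace.*ₗ-closed (perp-isSubspace b) a {z} z⊥b) ⟩
      ts S.+ᴹ S.0ᴹ ≡⟨ S.+ᴹ-identityʳ ts ⟩
      ts ∎

  perp-dimension : ∀ {n r} (b : Vec (Vec Carrier n) r) → LinearlyIndependent b →
                   ∃ λ s → s ℕ.+ r ≡ n × HasDimension (Perp b) s
  perp-dimension {n} {r} b indep with basis-exists {P = Perp b} (λ y → map (y ·_) b ≟ᵛ replicate r 0#)
  ... | s , z , isBasis = s , s+r≡n , z , isBasis
    where
    module B = IsBasis isBasis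
    module S {n} = LeftModule (coordinateSpace F n)

    section : Vec Carrier r → Vec Carrier n
    section t = proj₁ (interpolate b indep t)

    section-inverse : ∀ t → map (section t ·_) b ≡ t
    section-inverse t = proj₂ (interpolate b indep t)

    remainder : Vec Carrier n → Vec Carrier n
    remainder y = y ⊖ section (map (y ·_) b)

    remainder⊥b : ∀ y → remainder y ∈ Perp b
    remainder⊥b y = trans (homo-⊖ F (dots-linear b) y _) (≈⇒⊖≈0 (sym (section-inverse _)))

    split : Vec Carrier n → Vec Carrier s × Vec Carrier r
    split y = proj₁ (B.spanning (remainder⊥b y)) , map (y ·_) b

    join : Vec Carrier s × Vec Carrier r → Vec Carrier n
    join (c , t) = linearCombination c z S.+ᴹ section t

    join-split : ∀ y → join (split y) ≡ y
    join-split y = trans (cong (S._+ᴹ section _) (proj₂ (B.spanning (remainder⊥b y)))) (⊖-+ y _)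

    dots-join : ∀ c t → map (join (c , t) ·_) b ≡ t
    dots-join c t = trans (IsLinear.homo-+ (dots-linear b) (linearCombination c z) (section t))
      (trans (cong₂ S._+ᴹ_ (lc∈ (perp-isSubspace b) c B.members) (section-inverse t)) (S.+ᴹ-identityˡ t))

    join-injective : Injective _≡_ _≡_ join
    join-injective {c , t} {c′ , t′} eq = cong₂ _,_
      (independent⇒injective z B.independent c c′
        (+-cancelʳ (section t) (trans eq (cong (λ u → linearCombination c′ z S.+ᴹ section u) (sym t≡t′)))))
      t≡t′
      where
      open import Algebra.Properties.Group (LeftModule.+ᴹ-group (coordinateSpace F n))
        using () renaming (∙-cancelʳ to cancelʳ)
      +-cancelʳ = λ w {u} {v} → cancelʳ w u v
      t≡t′ : t ≡ t′
      t≡t′ = trans (sym (dots-join c t)) (trans (cong (λ y → map (y ·_) b) eq) (dots-join c′ t′))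

    pairs-card : (Vec Carrier s × Vec Carrier r) ↔ Fin (N ℕ.^ (s ℕ.+ r))
    pairs-card = subst (λ k → (Vec Carrier s × Vec Carrier r) ↔ Fin k) (sym (ℕ.^-distribˡ-+-* N s r))
      (×-card (Vec-card card s) (Vec-card card r))

    s+r≡n : s ℕ.+ r ≡ n
    s+r≡n = ℕ.≤-antisym
      (^-cancelʳ-≤ 1<card (injection⇒≤ pairs-card (Vec-card card n) join join-injective))
      (^-cancelʳ-≤ 1<card (injection⇒≤ (Vec-card card n) pairs-card split
        λ eq → trans (sym (join-split _)) (trans (cong join eq) (join-split _))))

  perp-has-dimension : ∀ {n s r} → s ℕ.+ r ≡ n → (b : Vec (Vec Carrier n) r) →
                       LinearlyIndependent b → HasDimension (Perp b) s
  perp-has-dimension {s = s} {r} s+r≡n b indep = subst (HasDimension (Perp b))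
    (ℕ.+-cancelʳ-≡ r (proj₁ dim) s (trans (proj₁ (proj₂ dim)) (sym s+r≡n))) (proj₂ (proj₂ dim))
    where
    dim = perp-dimension b indep

-- Arithmetic of finite fields

prime∤! : ∀ {p} → Prime p → ∀ m → m < p → ¬ p ∣ m !
prime∤! pr zero    m<p p∣1 = ¬prime[1] (subst Prime (∣1⇒≡1 p∣1) pr)
prime∤! pr (suc m) m<p p∣! = [ (λ p∣m → ℕ.<⇒≱ m<p (∣⇒≤ p∣m)) , prime∤! pr m (ℕ.<⇒≤ m<p) ]′
  (euclidsLemma (suc m) (m !) pr p∣!)

prime∣C : ∀ {p} → Prime p → ∀ k → 0 < k → k < p → p ∣ p ℕ.C k
prime∣C {p} pr k 0<k k<p with euclidsLemma (p ℕ.C k) (k ! ℕ.* (p ℕ.∸ k) !) pr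
    (subst (p ∣_) (sym C*≡p!) (p∣p! p (prime⇒nonZero pr)))
  where
  p∣p! : ∀ p → ℕ.NonZero p → p ∣ p !
  p∣p! (suc p) _ = m∣m*n (p !)

  instance
    _ = k !≢0
    _ = (p ℕ.∸ k) !≢0
    _ = ℕ.m*n≢0 (k !) ((p ℕ.∸ k) !)

  C*≡p! : (p ℕ.C k) ℕ.* (k ! ℕ.* (p ℕ.∸ k) !) ≡ p !
  C*≡p! = trans (cong (ℕ._* (k ! ℕ.* (p ℕ.∸ k) !)) (nCk≡n!/k![n-k]! (ℕ.<⇒≤ k<p)))
    (m/n*n≡m (subst (_∣ p !) (ℕ.*-comm ((p ℕ.∸ k) !) (k !)) ([n∸k]!k!∣n! (ℕ.<⇒≤ k<p))))
... | inj₁ p∣C = p∣C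
... | inj₂ p∣* = contradiction p∣*
  ([ prime∤! pr k k<p , prime∤! pr (p ℕ.∸ k) (ℕ.∸-monoʳ-< 0<k (ℕ.<⇒≤ k<p)) ]′ ∘ euclidsLemma (k !) _ pr)

module FieldProperties (F : Field) where
  open Field F
  module R = CommutativeRing commutativeRing
  open SemiringMult semiring using (×-assocˡ; ×-assoc-*; ×-congʳ) renaming (_×_ to _×ᶠ_)
  open SemiringExp semiring using (^-assocʳ; ^-congˡ)
  open ≡-Reasoning

  *-cancelʳ-nonzero : ∀ {x y z} → z ≢ 0# → x * z ≡ y * z → x ≡ y
  *-cancelʳ-nonzero {x} {y} {z} z≢0 eq = begin
    x             ≡⟨ R.*-identityʳ x ⟨
    x * 1#        ≡⟨ cong (x *_) zw ⟨
    x * (z * w)   ≡⟨ R.*-assoc x z w ⟨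
    x * z * w     ≡⟨ cong (_* w) eq ⟩
    y * z * w     ≡⟨ R.*-assoc y z w ⟩
    y * (z * w)   ≡⟨ cong (y *_) zw ⟩
    y * 1#        ≡⟨ R.*-identityʳ y ⟩
    y ∎
    where
    w = proj₁ (inverse z z≢0)
    zw = proj₂ (inverse z z≢0)

  *-nonzero : ∀ {x y} → x ≢ 0# → y ≢ 0# → x * y ≢ 0#
  *-nonzero x≢0 y≢0 eq = x≢0 (*-cancelʳ-nonzero y≢0 (trans eq (sym (R.zeroˡ _))))

  ^-nonzero : ∀ {x} → x ≢ 0# → ∀ n → x ^ n ≢ 0#
  ^-nonzero x≢0 zero    = 0≢1 ∘ sym
  ^-nonzero x≢0 (suc n) = *-nonzero x≢0 (^-nonzero x≢0 n)

  ×-multiple : ∀ {p} → p ×ᶠ 1# ≡ 0# → ∀ {n} → p ∣ n → ∀ x → n ×ᶠ x ≡ 0#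
  ×-multiple {p} char (divides c refl) x = begin
    (c ℕ.* p) ×ᶠ x     ≡⟨ ×-assocˡ x c p ⟨
    c ×ᶠ (p ×ᶠ x)      ≡⟨ cong (c ×ᶠ_) (cong (p ×ᶠ_) (R.*-identityˡ x)) ⟨
    c ×ᶠ (p ×ᶠ (1# * x)) ≡⟨ cong (c ×ᶠ_) (×-assoc-* p 1# x) ⟨
    c ×ᶠ ((p ×ᶠ 1#) * x) ≡⟨ cong (λ e → c ×ᶠ (e * x)) char ⟩
    c ×ᶠ (0# * x)      ≡⟨ ×-assoc-* c 0# x ⟨
    (c ×ᶠ 0#) * x      ≡⟨ cong (_* x) (×0 c) ⟩
    0# * x             ≡⟨ R.zeroˡ x ⟩
    0# ∎
    where
    ×0 : ∀ c → c ×ᶠ 0# ≡ 0#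
    ×0 zero    = refl
    ×0 (suc c) = trans (R.+-identityˡ _) (×0 c)

  frobenius-prime : ∀ {p} → Prime p → p ×ᶠ 1# ≡ 0# → ∀ x y → (x + y) ^ p ≡ x ^ p + y ^ p
  frobenius-prime {suc p} pr char x y = begin
    (x + y) ^ suc p              ≡⟨ Bin.theorem (suc p) x y ⟩
    sum (Bin.binomialTerm x y (suc p))
      ≡⟨ cong₂ _+_ first (trans (sum-init-last (term ∘ suc)) (cong₂ _+_ middle final)) ⟩
    y ^ suc p + (0# + x ^ suc p) ≡⟨ cong (y ^ suc p +_) (R.+-identityˡ _) ⟩
    y ^ suc p + x ^ suc p        ≡⟨ R.+-comm _ _ ⟩
    x ^ suc p + y ^ suc p ∎
    where
    module Bin = Binomial R.commutativeSemiring
    open Sum R.+-commutativeMonoid using (sum; sum-init-last; sum-cong-≗; sum-replicate-zero)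

    term = Bin.binomialTerm x y (suc p)

    first : term zero ≡ y ^ suc p
    first = trans (R.+-identityʳ _) (R.*-identityˡ _)

    final : term (suc (fromℕ p)) ≡ x ^ suc p
    final rewrite toℕ-fromℕ p | nCn≡1 (suc p) | ℕ.n∸n≡0 p = trans (R.+-identityʳ _) (R.*-identityʳ _)

    middle : sum (λ j → term (suc (inject₁ j))) ≡ 0#
    middle = trans (sum-cong-≗ λ j → ×-multiple char
        (prime∣C pr _ (s≤s z≤n) (s≤s (subst (_< p) (sym (toℕ-inject₁ j)) (toℕ<n j)))) _)
      (sum-replicate-zero p)

  frobenius : ∀ {p} → Prime p → p ×ᶠ 1# ≡ 0# → ∀ e x y →
              (x + y) ^ (p ℕ.^ e) ≡ x ^ (p ℕ.^ e) + y ^ (p ℕ.^ e)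
  frobenius pr char zero    x y = trans (R.*-identityʳ _)
    (sym (cong₂ _+_ (R.*-identityʳ x) (R.*-identityʳ y)))
  frobenius {p} pr char (suc e) x y = begin
    (x + y) ^ (p ℕ.* p ℕ.^ e)  ≡⟨ ^-assocʳ (x + y) p _ ⟨
    ((x + y) ^ p) ^ (p ℕ.^ e)  ≡⟨ cong (_^ (p ℕ.^ e)) (frobenius-prime pr char x y) ⟩
    (x ^ p + y ^ p) ^ (p ℕ.^ e) ≡⟨ frobenius pr char e _ _ ⟩
    (x ^ p) ^ (p ℕ.^ e) + (y ^ p) ^ (p ℕ.^ e)
      ≡⟨ cong₂ _+_ (^-assocʳ x p _) (^-assocʳ y p _) ⟩
    x ^ (p ℕ.* p ℕ.^ e) + y ^ (p ℕ.* p ℕ.^ e) ∎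

  data Monic : ℕ → (Carrier → Carrier) → Set where
    one  : ∀ {f} → (∀ x → f x ≡ 1#) → Monic 0 f
    step : ∀ {d f g} → Monic d g → ∀ c → (∀ x → f x ≡ x * g x + c) → Monic (suc d) f

  private
    minus-plus : ∀ x a → (x + - a) + a ≡ x
    minus-plus x a = trans (R.+-assoc x _ a)
      (trans (cong (x +_) (R.-‿inverseˡ a)) (R.+-identityʳ x))

  monic-factor : ∀ {d f} → Monic (suc d) f → ∀ a →
                 ∃ λ h → Monic d h × (∀ x → f x ≡ (x + - a) * h x + f a)
  monic-factor {f = f} (step {g = g} (one g≡1) c f≡) a = (λ _ → 1#) , one (λ _ → refl) , λ x → begin
    f x                              ≡⟨ value x ⟩
    x + c                            ≡⟨ cong (_+ c) (minus-plus x a) ⟨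
    (x + - a) + a + c                ≡⟨ R.+-assoc _ a c ⟩
    (x + - a) + (a + c)              ≡⟨ cong₂ _+_ (R.*-identityʳ _) (value a) ⟨
    (x + - a) * 1# + f a ∎
    where
    value : ∀ x → f x ≡ x + c
    value x = trans (f≡ x) (cong (_+ c) (trans (cong (x *_) (g≡1 x)) (R.*-identityʳ x)))
  monic-factor {f = f} (step {g = g} m@(step _ _ _) c f≡) a with monic-factor m a
  ... | h , mh , eq = (λ x → x * h x + g a) , step mh (g a) (λ _ → refl) , λ x → begin
    f x                                      ≡⟨ f≡ x ⟩
    x * g x + c                              ≡⟨ cong (λ e → x * e + c) (eq x) ⟩
    x * ((x + - a) * h x + g a) + c          ≡⟨ expand x (x + - a) (h x) (g a) ⟩
    (x + - a) * (x * h x) + x * g a + c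
      ≡⟨ cong (λ e → (x + - a) * (x * h x) + e * g a + c) (minus-plus x a) ⟨
    (x + - a) * (x * h x) + ((x + - a) + a) * g a + c
      ≡⟨ collect (x + - a) (x * h x) (g a) ⟩
    (x + - a) * (x * h x + g a) + (a * g a + c)
      ≡⟨ cong ((x + - a) * (x * h x + g a) +_) (f≡ a) ⟨
    (x + - a) * (x * h x + g a) + f a ∎
    where
    open import Algebra.Solver.Ring.NaturalCoefficients.Default R.commutativeSemiring
    expand : ∀ x y h g → x * (y * h + g) + c ≡ y * (x * h) + x * g + c
    expand x y h g = solve 5 (λ x y h g c →
      x :* (y :* h :+ g) :+ c := y :* (x :* h) :+ x :* g :+ c) refl x y h g c
    collect : ∀ y h g → y * h + (y + a) * g + c ≡ y * (h + g) + (a * g + c)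
    collect y h g = solve 5 (λ y h g a c →
      y :* h :+ (y :+ a) :* g :+ c := y :* (h :+ g) :+ (a :* g :+ c)) refl y h g a c

  monic-roots : ∀ {d f} → Monic d f → (r : Fin (suc d) → Carrier) → Injective _≡_ _≡_ r →
                ¬ (∀ i → f (r i) ≡ 0#)
  monic-roots         (one f≡1)      r inj root = 0≢1 (trans (sym (root zero)) (f≡1 _))
  monic-roots {f = f} m@(step _ _ _) r inj root with monic-factor m (r zero)
  ... | h , mh , eq = monic-roots mh (r ∘ suc) (Fin.suc-injective ∘ inj) λ i →
    *-cancelʳ-nonzero (differ i) (begin
      h (r (suc i)) * (r (suc i) + - r zero)              ≡⟨ R.*-comm _ _ ⟩
      (r (suc i) + - r zero) * h (r (suc i))              ≡⟨ R.+-identityʳ _ ⟨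
      (r (suc i) + - r zero) * h (r (suc i)) + 0#         ≡⟨ cong (_ +_) (root zero) ⟨
      (r (suc i) + - r zero) * h (r (suc i)) + f (r zero) ≡⟨ eq (r (suc i)) ⟨
      f (r (suc i))                                       ≡⟨ root (suc i) ⟩
      0#                                                  ≡⟨ R.zeroˡ _ ⟨
      0# * (r (suc i) + - r zero) ∎)
    where
    differ : ∀ i → r (suc i) + - r zero ≢ 0#
    differ i eq with () ← inj (GroupProperties.x∙y⁻¹≈ε⇒x≈y R.+-group _ _ eq)

  power-monic : ∀ d → Monic d (_^ d)
  power-monic zero    = one λ _ → refl
  power-monic (suc d) = step (power-monic d) 0# λ _ → sym (R.+-identityʳ _)

  frobenius-monic : ∀ d → Monic (2 ℕ.+ d) (λ x → x ^ (2 ℕ.+ d) + - x)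
  frobenius-monic d = step (step (power-monic d) (- 1#) λ _ → refl) 0# λ x → sym (begin
    x * (x ^ suc d + - 1#) + 0#   ≡⟨ R.+-identityʳ _ ⟩
    x * (x ^ suc d + - 1#)        ≡⟨ R.distribˡ x _ _ ⟩
    x * x ^ suc d + x * - 1#      ≡⟨ cong (x * x ^ suc d +_) (RingProperties.-‿distribʳ-* R.ring x 1#) ⟨
    x * x ^ suc d + - (x * 1#)    ≡⟨ cong (λ e → x * x ^ suc d + - e) (R.*-identityʳ x) ⟩
    x * x ^ suc d + - x ∎)

module TotalSum {A : Set} {N : ℕ} (card : A ↔ Fin N) (M : CommutativeMonoid 0ℓ 0ℓ) where
  open CommutativeMonoid M
  open Sum M
  open Inverse card

  total : (A → Carrier) → Carrier
  total f = sum (f ∘ from)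

  total-cong : ∀ {f g : A → Carrier} → (∀ x → f x ≈ g x) → total f ≈ total g
  total-cong f≈g = sum-cong-≋ (f≈g ∘ from)

  total-permute : ∀ (g : A ↔ A) (f : A → Carrier) → total f ≈ total (f ∘ Inverse.to g)
  total-permute g f = CommutativeMonoid.trans M (sum-permute (f ∘ from) (card ↔-∘ (g ↔-∘ ↔-sym card)))
    (sum-cong-≋ λ i → reflexive (cong f (strictlyInverseʳ (Inverse.to g (from i)))))

  total-distrib : ∀ (f g : A → Carrier) → total (λ x → f x ∙ g x) ≈ total f ∙ total g
  total-distrib f g = ∑-distrib-+ (f ∘ from) (g ∘ from)

module FiniteField (F : Field) {N : ℕ} (card : Field.Carrier F ↔ Fin N) where
  open Field F
  open FieldProperties F
  open Finite card using (_≟_)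
  open Inverse card using (to; from; strictlyInverseˡ; strictlyInverseʳ)
  open SemiringMult semiring using (×1-homo-*) renaming (_×_ to _×ᶠ_)
  open ≡-Reasoning

  order-annihilates : N ×ᶠ 1# ≡ 0#
  order-annihilates = GroupProperties.identityʳ-unique R.+-group (total id) _ (begin
    total id + N ×ᶠ 1#          ≡⟨ cong (total id +_) (sum-replicate N) ⟨
    total id + total (λ _ → 1#) ≡⟨ total-distrib id (λ _ → 1#) ⟨
    total (_+ 1#)               ≡⟨ total-permute translation id ⟨
    total id ∎)
    where
    open TotalSum card R.+-commutativeMonoid
    open Sum R.+-commutativeMonoid using (sum-replicate)
    translation : Carrier ↔ Carrier
    translation = mk↔ₛ′ (_+ 1#) (_+ - 1#)
      (λ x → trans (R.+-assoc x _ _) (trans (cong (x +_) (R.-‿inverseˡ 1#)) (R.+-identityʳ x)))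
      (λ x → trans (R.+-assoc x _ _) (trans (cong (x +_) (R.-‿inverseʳ 1#)) (R.+-identityʳ x)))

  characteristic : ∀ {p e} → N ≡ p ℕ.^ e → p ×ᶠ 1# ≡ 0#
  characteristic {p} {e} N≡ with p ×ᶠ 1# ≟ 0#
  ... | yes eq = eq
  ... | no p≢0 = contradiction
    (trans (sym (power e)) (trans (cong (_×ᶠ 1#) (sym N≡)) order-annihilates)) (^-nonzero p≢0 e)
    where
    power : ∀ e → (p ℕ.^ e) ×ᶠ 1# ≡ (p ×ᶠ 1#) ^ e
    power zero    = R.+-identityʳ 1#
    power (suc e) = trans (×1-homo-* p (p ℕ.^ e)) (cong (p ×ᶠ 1# *_) (power e))

  -- Both sides of a · ∏ₓ f(x) = aᴺ · ∏ₓ f(x) compute ∏ₓ f(ax) · e(x), where f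
  -- replaces 0 by 1 and e is a at 0 and 1 elsewhere.
  fermat : ∀ a → a ^ N ≡ a
  fermat a with a ≟ 0#
  ... | yes refl = zero-power N (to 0#)
    where
    zero-power : ∀ n → Fin n → 0# ^ n ≡ 0#
    zero-power (suc n) _ = R.zeroˡ _
  ... | no a≢0 = sym (*-cancelʳ-nonzero (product-nonzero _ (f-nonzero ∘ from)) (begin
    a * total f               ≡⟨ cong (_* total f) total-e ⟨
    total e * total f         ≡⟨ R.*-comm _ _ ⟩
    total f * total e         ≡⟨ cong (_* total e) (total-permute scaling f) ⟩
    total (f ∘ (a *_)) * total e ≡⟨ total-distrib (f ∘ (a *_)) e ⟨
    total (λ x → f (a * x) * e x) ≡⟨ total-cong f-scale ⟩
    total (λ x → a * f x)     ≡⟨ total-distrib (λ _ → a) f ⟩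
    total (λ _ → a) * total f ≡⟨ cong (_* total f) (sum-replicate N) ⟩
    a ^ N * total f ∎))
    where
    open TotalSum card R.*-commutativeMonoid
    open Sum R.*-commutativeMonoid using (sum; sum-replicate; sum-remove; sum-cong-≗; sum-replicate-zero)

    b = proj₁ (inverse a a≢0)
    ab = proj₂ (inverse a a≢0)

    f e : Carrier → Carrier
    f x with x ≟ 0#
    ... | yes _ = 1#
    ... | no _  = x
    e x with x ≟ 0#
    ... | yes _ = a
    ... | no _  = 1#

    f-nonzero : ∀ x → f x ≢ 0#
    f-nonzero x with x ≟ 0#
    ... | yes _  = 0≢1 ∘ sym
    ... | no x≢0 = x≢0

    product-nonzero : ∀ n {t : Fin n → Carrier} → (∀ i → t i ≢ 0#) → sum t ≢ 0#
    product-nonzero zero    nz = 0≢1 ∘ sym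
    product-nonzero (suc n) nz = *-nonzero (nz zero) (product-nonzero n (nz ∘ suc))

    f-scale : ∀ x → f (a * x) * e x ≡ a * f x
    f-scale x with x ≟ 0# | a * x ≟ 0#
    ... | yes _    | yes _  = R.*-comm 1# a
    ... | yes refl | no ≢0  = contradiction (R.zeroʳ a) ≢0
    ... | no x≢0   | yes ≡0 = contradiction ≡0 (*-nonzero a≢0 x≢0)
    ... | no _     | no _   = R.*-identityʳ _

    scaling : Carrier ↔ Carrier
    scaling = mk↔ₛ′ (a *_) (b *_)
      (λ x → trans (sym (R.*-assoc a b x)) (trans (cong (_* x) ab) (R.*-identityˡ x)))
      (λ x → trans (sym (R.*-assoc b a x))
        (trans (cong (_* x) (trans (R.*-comm b a) ab)) (R.*-identityˡ x)))

    e-zero : e 0# ≡ a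
    e-zero with 0# ≟ 0#
    ... | yes _ = refl
    ... | no ≢0 = contradiction refl ≢0

    e-nonzero : ∀ {x} → x ≢ 0# → e x ≡ 1#
    e-nonzero {x} x≢0 with x ≟ 0#
    ... | yes ≡0 = contradiction ≡0 x≢0
    ... | no _   = refl

    product-at : ∀ n (t : Fin n → Carrier) i → (∀ j → j ≢ i → t j ≡ 1#) → sum t ≡ t i
    product-at (suc n) t i others = begin
      sum t ≡⟨ sum-remove t ⟩
      t i * sum (λ j → t (punchIn i j))
        ≡⟨ cong (t i *_) (trans (sum-cong-≗ λ j → others _ (punchInᵢ≢i i j)) (sum-replicate-zero n)) ⟩
      t i * 1# ≡⟨ R.*-identityʳ _ ⟩
      t i ∎

    total-e : total e ≡ a
    total-e = trans (product-at N (e ∘ from) (to 0#) λ j j≢ → e-nonzero λ eq →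
        j≢ (trans (sym (strictlyInverseˡ j)) (cong to eq)))
      (trans (cong e (strictlyInverseʳ 0#)) e-zero)

-- Field extensions and rank supports

map-transpose : ∀ {A B : Set} (f : A → B) {m n} (M : Vec (Vec A n) m) →
                map (map f) (transpose M) ≡ transpose (map (map f) M)
map-transpose f {n = n} []      = map-replicate (map f) [] n
map-transpose f         (r ∷ M) = trans (cons r (transpose M))
  (cong ((replicate _ _∷_ ⊛ map f r) ⊛_) (map-transpose f M))
  where
  cons : ∀ {n m} (r : Vec _ n) (T : Vec (Vec _ m) n) → map (map f) ((replicate n _∷_ ⊛ r) ⊛ T) ≡
                     ((replicate n _∷_ ⊛ map f r) ⊛ map (map f) T)
  cons []      []      = refl
  cons (x ∷ r) (t ∷ T) = cong (_ ∷_) (cons r T)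

module _ (F : Field) {M N : VectorSpace F}
         {f : LeftModule.Carrierᴹ M → LeftModule.Carrierᴹ N} (linear : IsLinear F M N f) where
  open IsLinear linear
  private
    module M = LeftModule M
    module N = LeftModule N
    module LM = LinearAlgebra F M
    module LN = LinearAlgebra F N

  map-independent : (∀ v → f v N.≈ᴹ N.0ᴹ → v M.≈ᴹ M.0ᴹ) → ∀ {d} {b : Vec M.Carrierᴹ d} →
                    LM.LinearlyIndependent b → LN.LinearlyIndependent (map f b)
  map-independent ker {b = b} indep c eq = indep c (ker _ (N.≈ᴹ-trans (lc-homo F linear c b) eq))

  map-independent⁻ : ∀ {d} {b : Vec M.Carrierᴹ d} →
                     LN.LinearlyIndependent (map f b) → LM.LinearlyIndependent b
  map-independent⁻ {b = b} indep c eq = indep c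
    (N.≈ᴹ-trans (N.≈ᴹ-sym (lc-homo F linear c b)) (N.≈ᴹ-trans (cong-≈ eq) homo-0))

module Extension {q m : ℕ} (E : FiniteFieldExtension q m) where
  open FiniteFieldExtension E
  module KF = FiniteLinearAlgebra 𝔽q card-𝔽q
  module LF = FiniteLinearAlgebra 𝔽qᵐ card-𝔽qᵐ
  module KD = DotProduct 𝔽q
  module LD = DotProduct 𝔽qᵐ
  open LD using (_·_; ·-comm; ·-lc)
  module H = IsRingHomomorphism isRingHomomorphism
  module RL = CommutativeRing L.commutativeRing
  module RK = CommutativeRing K.commutativeRing

  ι-injective : Injective _≡_ _≡_ ι
  ι-injective {x} {y} eq with x KF.≟ y
  ... | yes x≡y = x≡y
  ... | no x≢y with K.inverse (x K.+ K.- y) (x≢y ∘ x∙y⁻¹≈ε⇒x≈y x y)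
    where open import Algebra.Properties.Group RK.+-group
  ...   | w , inv = contradiction (sym (begin
    L.1#                            ≡⟨ H.1#-homo ⟨
    ι K.1#                          ≡⟨ cong ι inv ⟨
    ι ((x K.+ K.- y) K.* w)         ≡⟨ H.*-homo _ w ⟩
    ι (x K.+ K.- y) L.* ι w
      ≡⟨ cong (L._* ι w) (trans (H.+-homo x _) (cong₂ L._+_ eq (H.-‿homo y))) ⟩
    (ι y L.+ L.- ι y) L.* ι w       ≡⟨ cong (L._* ι w) (RL.-‿inverseʳ (ι y)) ⟩
    L.0# L.* ι w                    ≡⟨ RL.zeroˡ _ ⟩
    L.0# ∎)) L.0≢1
    where open ≡-Reasoning

  ιᵛ : ∀ {n} → Vec K.Carrier n → Vec L.Carrier n
  ιᵛ = map ι

  restrict-lc : ∀ (M : VectorSpace 𝔽qᵐ) {d} (c : Vec K.Carrier d) b →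
                LinearAlgebra.linearCombination 𝔽q (restrict M) c b ≡
                LinearAlgebra.linearCombination 𝔽qᵐ M (ιᵛ c) b
  restrict-lc M []      []      = refl
  restrict-lc M (x ∷ c) (v ∷ b) = cong (ι x *ₗ v +ᴹ_) (restrict-lc M c b)
    where open LeftModule M

  ι-linear : IsLinear 𝔽q KD.scalars (restrict LD.scalars) ι
  ι-linear = record { cong-≈ = cong ι ; homo-+ = H.+-homo ; homo-* = H.*-homo }

  ιᵛ-linear : ∀ {n} → IsLinear 𝔽q (coordinateSpace 𝔽q n) (restrict (coordinateSpace 𝔽qᵐ n)) ιᵛ
  ιᵛ-linear = record { cong-≈ = cong ιᵛ ; homo-+ = plus ; homo-* = scale }
    where
    plus : ∀ {n} (u v : Vec K.Carrier n) → ιᵛ (zipWith K._+_ u v) ≡ zipWith L._+_ (ιᵛ u) (ιᵛ v)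
    plus []      []      = refl
    plus (x ∷ u) (y ∷ v) = cong₂ _∷_ (H.+-homo x y) (plus u v)
    scale : ∀ {n} a (v : Vec K.Carrier n) → ιᵛ (map (a K.*_) v) ≡ map (ι a L.*_) (ιᵛ v)
    scale a []      = refl
    scale a (x ∷ v) = cong₂ _∷_ (H.*-homo a x) (scale a v)

  ιᵛ-0 : ∀ n → ιᵛ (replicate n K.0#) ≡ replicate n L.0#
  ιᵛ-0 n = IsLinear.homo-0 (ιᵛ-linear {n})

  ι-· : ∀ {n} (u v : Vec K.Carrier n) → ι (u KD.· v) ≡ ιᵛ u · ιᵛ v
  ι-· u v = trans (lc-homo 𝔽q ι-linear u v) (restrict-lc LD.scalars u (ιᵛ v))

  ι-lc : ∀ {n d} (c : Vec K.Carrier d) (b : Vec (Vec K.Carrier n) d) →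
         ιᵛ (Kⁿ.linearCombination n c b) ≡ Lⁿ.linearCombination n (ιᵛ c) (map ιᵛ b)
  ι-lc c b = trans (lc-homo 𝔽q ιᵛ-linear c b) (restrict-lc (coordinateSpace 𝔽qᵐ _) c (map ιᵛ b))

  ι-span : ∀ {n d} {b : Vec (Vec K.Carrier n) d} {v} → v ∈ Kⁿ.Span n b → ιᵛ v ∈ Lⁿ.Span n (map ιᵛ b)
  ι-span {b = b} (c , eq) = ιᵛ c , trans (sym (ι-lc c b)) (cong ιᵛ eq)

  ι-dots : ∀ {n d} (y : Vec K.Carrier n) (b : Vec (Vec K.Carrier n) d) →
           map (ιᵛ y ·_) (map ιᵛ b) ≡ ιᵛ (map (y KD.·_) b)
  ι-dots y []      = refl
  ι-dots y (v ∷ b) = cong₂ _∷_ (sym (ι-· y v)) (ι-dots y b)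

  ι-perp : ∀ {n d} {b : Vec (Vec K.Carrier n) d} {y} → y ∈ KD.Perp b → ιᵛ y ∈ LD.Perp (map ιᵛ b)
  ι-perp {d = d} {b} {y} p = trans (ι-dots y b) (trans (cong ιᵛ p) (ιᵛ-0 d))

  rational-dual : ∀ {n} (c : Vec L.Carrier n) → (∀ t → ιᵛ t · c ≡ L.0#) → c ≡ replicate n L.0#
  rational-dual []      h = refl
  rational-dual (x ∷ c) h = cong₂ _∷_ head≡0 (rational-dual c λ t →
    trans (sym (Combinations.skip 𝔽qᵐ LD.scalars (ιᵛ t) (ι K.0#) H.0#-homo)) (h (K.0# ∷ t)))
    where
    open ≡-Reasoning
    head≡0 : x ≡ L.0#
    head≡0 = begin
      x                                             ≡⟨ RL.*-identityˡ x ⟨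
      L.1# L.* x                                    ≡⟨ cong (L._* x) H.1#-homo ⟨
      ι K.1# L.* x                                  ≡⟨ RL.+-identityʳ _ ⟨
      ι K.1# L.* x L.+ L.0#                         ≡⟨ cong (_ L.+_) (IsLinear.homo-0 (LD.·-linearˡ c)) ⟨
      ι K.1# L.* x L.+ replicate _ L.0# · c         ≡⟨ cong (λ t → ι K.1# L.* x L.+ t · c) (ιᵛ-0 _) ⟨
      ι K.1# L.* x L.+ ιᵛ (replicate _ K.0#) · c    ≡⟨ h (K.1# ∷ replicate _ K.0#) ⟩
      L.0# ∎

  ι-independent : ∀ {n d} {b : Vec (Vec K.Carrier n) d} →
                  Kⁿ.LinearlyIndependent n b → Lⁿ.LinearlyIndependent n (map ιᵛ b)
  ι-independent {n} {b = b} indep c eq = rational-dual c λ t →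
    let y , yb = KF.interpolate b indep t in begin
    ιᵛ t · c                           ≡⟨ ·-comm (ιᵛ t) c ⟩
    c · ιᵛ t                           ≡⟨ cong (λ t → c · ιᵛ t) yb ⟨
    c · ιᵛ (map (y KD.·_) b)           ≡⟨ cong (c ·_) (ι-dots y b) ⟨
    c · map (ιᵛ y ·_) (map ιᵛ b)       ≡⟨ ·-lc (ιᵛ y) c (map ιᵛ b) ⟨
    ιᵛ y · Lⁿ.linearCombination n c (map ιᵛ b) ≡⟨ cong (ιᵛ y ·_) eq ⟩
    ιᵛ y · replicate n L.0#            ≡⟨ IsLinear.homo-0 (LD.·-linearʳ (ιᵛ y)) ⟩
    L.0# ∎
    where open ≡-Reasoning

  restrict-subspace : ∀ {M : VectorSpace 𝔽qᵐ} {P} → LinearAlgebra.IsSubspace 𝔽qᵐ M P →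
                      LinearAlgebra.IsSubspace 𝔽q (restrict M) P
  restrict-subspace isSub = record
    { ≈ᴹ-closed = ≈ᴹ-closed ; 0ᴹ-closed = 0ᴹ-closed
    ; +ᴹ-closed = +ᴹ-closed ; *ₗ-closed = λ a → *ₗ-closed (ι a) }
    where open LinearAlgebra.IsSubspace isSub

  module Support {Γ : Vec L.Carrier m} (isBasis : IsOrderedBasis Γ) where
    open RankSupport E isBasis

    private
      value : ∀ x → L/K.linearCombination (coordinates x) Γ ≡ x
      value x = proj₂ (L/K.IsBasis.spanning isBasis {x} tt)

      module Γ = IsLinear (Combinations.lc-linear 𝔽q (restrict LD.scalars) Γ)

      coordinates-unique : ∀ {c x} → L/K.linearCombination c Γ ≡ x → coordinates x ≡ c
      coordinates-unique eq = Combinations.independent⇒injective 𝔽q (restrict LD.scalars) Γ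
        (L/K.IsBasis.independent isBasis) _ _ (trans (value _) (sym eq))

    coordinates-linear : IsLinear 𝔽q (restrict LD.scalars) (coordinateSpace 𝔽q m) coordinates
    coordinates-linear = record
      { cong-≈ = cong coordinates
      ; homo-+ = λ x y → coordinates-unique
          (trans (Γ.homo-+ (coordinates x) (coordinates y)) (cong₂ L._+_ (value x) (value y)))
      ; homo-* = λ a x → coordinates-unique
          (trans (Γ.homo-* a (coordinates x)) (cong (ι a L.*_) (value x)))
      }

    support-functional : ∀ {n} (v : Vec L.Carrier n) c y →
      y KD.· Kⁿ.linearCombination n c (transpose Γ⟨ v ⟩) ≡ c KD.· coordinates (ιᵛ y · v)
    support-functional {n} v c y = begin
      y KD.· Kⁿ.linearCombination n c (transpose Γ⟨ v ⟩) ≡⟨ cong (y KD.·_) (KD.lc-transpose c Γ⟨ v ⟩) ⟩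
      y KD.· map (c KD.·_) Γ⟨ v ⟩                ≡⟨ KD.·-lc c y Γ⟨ v ⟩ ⟨
      c KD.· Kⁿ.linearCombination m y Γ⟨ v ⟩     ≡⟨ cong (c KD.·_) (lc-homo 𝔽q coordinates-linear y v) ⟨
      c KD.· coordinates (L/K.linearCombination y v)
        ≡⟨ cong (λ x → c KD.· coordinates x) (restrict-lc LD.scalars y v) ⟩
      c KD.· coordinates (ιᵛ y · v) ∎
      where open ≡-Reasoning

    annihilates⇒⊥support : ∀ {n} {v : Vec L.Carrier n} {y} → ιᵛ y · v ≡ L.0# →
                           ∀ {w} → w ∈ σʳᵏ v → y KD.· w ≡ K.0#
    annihilates⇒⊥support {v = v} {y} eq (c , refl) = begin
      y KD.· _                          ≡⟨ support-functional v c y ⟩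
      c KD.· coordinates (ιᵛ y · v)     ≡⟨ cong (λ x → c KD.· coordinates x) eq ⟩
      c KD.· coordinates L.0#           ≡⟨ cong (c KD.·_) (IsLinear.homo-0 coordinates-linear) ⟩
      c KD.· replicate m K.0#           ≡⟨ IsLinear.homo-0 (KD.·-linearʳ c) ⟩
      K.0# ∎
      where open ≡-Reasoning

    ⊥support⇒annihilates : ∀ {n} {v : Vec L.Carrier n} {y} →
                           (∀ {w} → w ∈ σʳᵏ v → y KD.· w ≡ K.0#) → ιᵛ y · v ≡ L.0#
    ⊥support⇒annihilates {v = v} {y} h = begin
      ιᵛ y · v                                          ≡⟨ value _ ⟨
      L/K.linearCombination (coordinates (ιᵛ y · v)) Γ
        ≡⟨ cong (λ c → L/K.linearCombination c Γ)
             (KF.orthogonal-to-all⇒0 λ c → trans (sym (support-functional v c y)) (h (c , refl))) ⟩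
      L/K.linearCombination (replicate m K.0#) Γ        ≡⟨ Γ.homo-0 ⟩
      L.0# ∎
      where open ≡-Reasoning

    support-⊆ : ∀ {n} {v v′ : Vec L.Carrier n} →
                (∀ y → ιᵛ y · v ≡ L.0# → ιᵛ y · v′ ≡ L.0#) → σʳᵏ v′ ⊆ σʳᵏ v
    support-⊆ {v = v} {v′} h {w} w∈ = KF.perp-perp⊆span (transpose Γ⟨ v ⟩) λ y y⊥ →
      annihilates⇒⊥support {v = v′} {y}
        (h y (⊥support⇒annihilates {v = v} {y} (KD.perp-span {b = transpose Γ⟨ v ⟩} {y} y⊥))) w∈

    supportSpace : ∀ {n} → Vec L.Carrier n → Vec (Vec L.Carrier n) m
    supportSpace v = map ιᵛ (transpose Γ⟨ v ⟩)

    support-⊆⇒∈supportSpace : ∀ {n} {v v′ : Vec L.Carrier n} →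
                              σʳᵏ v′ ⊆ σʳᵏ v → v′ ∈ Lⁿ.Span n (supportSpace v)
    support-⊆⇒∈supportSpace {n} {v} {v′} sub = subst (_∈ Lⁿ.Span n (supportSpace v)) expansion
      (Combinations.lc∈ 𝔽qᵐ (coordinateSpace 𝔽qᵐ n)
        (Combinations.span-isSubspace 𝔽qᵐ (coordinateSpace 𝔽qᵐ n) (supportSpace v)) Γ
        (map⁺ (AllVec.map (λ {w} w∈ → ι-span {b = transpose Γ⟨ v ⟩} {w} (sub w∈))
          (Combinations.members∈span 𝔽q (coordinateSpace 𝔽q n) (transpose Γ⟨ v′ ⟩)))))
      where
      open ≡-Reasoning
      expansion : Lⁿ.linearCombination n Γ (supportSpace v′) ≡ v′
      expansion = begin
        Lⁿ.linearCombination n Γ (map ιᵛ (transpose Γ⟨ v′ ⟩))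
          ≡⟨ cong (Lⁿ.linearCombination n Γ) (map-transpose ι Γ⟨ v′ ⟩) ⟩
        Lⁿ.linearCombination n Γ (transpose (map ιᵛ Γ⟨ v′ ⟩)) ≡⟨ LD.lc-transpose Γ (map ιᵛ Γ⟨ v′ ⟩) ⟩
        map (Γ ·_) (map ιᵛ Γ⟨ v′ ⟩)             ≡⟨ map-∘ (Γ ·_) ιᵛ Γ⟨ v′ ⟩ ⟨
        map (λ c → Γ · ιᵛ c) (map coordinates v′) ≡⟨ map-∘ (λ c → Γ · ιᵛ c) coordinates v′ ⟨
        map (λ x → Γ · ιᵛ (coordinates x)) v′
          ≡⟨ map-cong (λ x → trans (·-comm Γ _)
               (trans (sym (restrict-lc LD.scalars (coordinates x) Γ)) (value x))) v′ ⟩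
        map id v′                               ≡⟨ map-id v′ ⟩
        v′ ∎

    nondegenerate⇒separated : ∀ {n} {C : Pred (Vec L.Carrier n) 0ℓ} → Nondegenerate C →
      ∀ y → (∀ v → v ∈ C → ιᵛ y · v ≡ L.0#) → y ≡ replicate n K.0#
    nondegenerate⇒separated {n} {C} nondeg y h = KF.orthogonal-to-all⇒0 λ w →
      trans (KD.·-comm w y) (orthogonal (proj₂ nondeg tt))
      where
      orthogonal : ∀ {w} → w ∈ Kⁿ.SumOfFamily n C σʳᵏ → y KD.· w ≡ K.0#
      orthogonal ([] , [] , refl) = IsLinear.homo-0 (KD.·-linearʳ y)
      orthogonal (u ∷ us , (v , v∈C , u∈) ∷ rest , refl) = trans (IsLinear.homo-+ (KD.·-linearʳ y) u _)
        (trans (cong₂ K._+_ (annihilates⇒⊥support {v = v} {y} (h v v∈C) u∈) (orthogonal (us , rest , refl)))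
               (RK.+-identityˡ K.0#))

-- Frobenius-stable subspaces

module Frobenius {q m : ℕ} (E : FiniteFieldExtension q m) (primePower : IsPrimePower q) where
  open FiniteFieldExtension E
  open Extension E
  open SemiringExp L.semiring using (^-assocʳ)
  open CommutativeExp RL.commutativeSemiring using (^-distrib-*)
  open ≡-Reasoning

  frob : L.Carrier → L.Carrier
  frob = L._^ q

  frob-ι : ∀ a → frob (ι a) ≡ ι a
  frob-ι a = trans (sym (power q)) (cong ι (FiniteField.fermat 𝔽q card-𝔽q a))
    where
    power : ∀ n → ι (a K.^ n) ≡ ι a L.^ n
    power zero    = H.1#-homo
    power (suc n) = trans (H.*-homo a _) (cong (ι a L.*_) (power n))

  frob-+ : ∀ x y → frob (x L.+ y) ≡ frob x L.+ frob y
  frob-+ = additive primePower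
    where
    open SemiringMult K.semiring using () renaming (_×_ to _×ᴷ_)
    open SemiringMult L.semiring using () renaming (_×_ to _×ᴸ_)
    ι-multiple : ∀ n → ι (n ×ᴷ K.1#) ≡ n ×ᴸ L.1#
    ι-multiple zero    = H.0#-homo
    ι-multiple (suc n) = trans (H.+-homo _ _) (cong₂ L._+_ H.1#-homo (ι-multiple n))

    additive : IsPrimePower q → ∀ x y → frob (x L.+ y) ≡ frob x L.+ frob y
    additive (p , e , p-prime , _ , q≡pᵉ) = subst (λ q → ∀ x y → (x L.+ y) L.^ q ≡ x L.^ q L.+ y L.^ q)
      (sym q≡pᵉ) (FieldProperties.frobenius 𝔽qᵐ p-prime
        (trans (sym (ι-multiple p)) (trans (cong ι characteristic-𝔽q) H.0#-homo)) e)
      where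
      characteristic-𝔽q : p ×ᴷ K.1# ≡ K.0#
      characteristic-𝔽q = FiniteField.characteristic 𝔽q card-𝔽q {p} {e} q≡pᵉ

  frob-* : ∀ x y → frob (x L.* y) ≡ frob x L.* frob y
  frob-* x y = ^-distrib-* x y q

  frob-0 : frob L.0# ≡ L.0#
  frob-0 = trans (cong frob (sym H.0#-homo)) (trans (frob-ι K.0#) H.0#-homo)

  frob-1 : frob L.1# ≡ L.1#
  frob-1 = trans (cong frob (sym H.1#-homo)) (trans (frob-ι K.1#) H.1#-homo)

  frob-surjective : 1 ≤ m → ∀ x → ∃ λ y → frob y ≡ x
  frob-surjective (s≤s {n = m′} _) x = x L.^ (q ℕ.^ m′) , (begin
    (x L.^ (q ℕ.^ m′)) L.^ q   ≡⟨ ^-assocʳ x (q ℕ.^ m′) q ⟩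
    x L.^ (q ℕ.^ m′ ℕ.* q)     ≡⟨ cong (x L.^_) (ℕ.*-comm (q ℕ.^ m′) q) ⟩
    x L.^ (q ℕ.^ suc m′)       ≡⟨ FiniteField.fermat 𝔽qᵐ card-𝔽qᵐ x ⟩
    x ∎)

  frob-fixed⇒rational : ∀ x → frob x ≡ x → ∃ λ a → ι a ≡ x
  frob-fixed⇒rational x fixed with Finite.any? card-𝔽q (λ a → ι a LF.≟ x)
  ... | yes a = a
  ... | no ∄a = contradiction root (FieldProperties.monic-roots 𝔽qᵐ
      (monic q KF.1<card) r r-injective)
    where
    monic : ∀ q → 1 < q → FieldProperties.Monic 𝔽qᵐ q (λ x → x L.^ q L.+ L.- x)
    monic (suc (suc d)) _ = FieldProperties.frobenius-monic 𝔽qᵐ d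
    monic (suc zero) (s≤s ())

    r : Fin (suc q) → L.Carrier
    r zero    = x
    r (suc i) = ι (Inverse.from card-𝔽q i)

    r-injective : Injective _≡_ _≡_ r
    r-injective {zero}  {zero}  eq = refl
    r-injective {zero}  {suc j} eq = contradiction (_ , sym eq) ∄a
    r-injective {suc i} {zero}  eq = contradiction (_ , eq) ∄a
    r-injective {suc i} {suc j} eq = cong suc (from-injective card-𝔽q (ι-injective eq))

    root : ∀ i → frob (r i) L.+ L.- r i ≡ L.0#
    root zero    = GroupProperties.x≈y⇒x∙y⁻¹≈ε RL.+-group fixed
    root (suc i) = GroupProperties.x≈y⇒x∙y⁻¹≈ε RL.+-group (frob-ι _)

  frobᵛ : ∀ {n} → Vec L.Carrier n → Vec L.Carrier n
  frobᵛ = map frob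

  frobᵛ-fixed⇒rational : ∀ {n} (v : Vec L.Carrier n) → frobᵛ v ≡ v → ∃ λ a → ιᵛ a ≡ v
  frobᵛ-fixed⇒rational []      _  = [] , refl
  frobᵛ-fixed⇒rational (x ∷ v) eq with ∷-injective eq
  ... | eqx , eqv with frob-fixed⇒rational x eqx | frobᵛ-fixed⇒rational v eqv
  ...   | a , refl | as , refl = a ∷ as , refl

  frobᵛ-ιᵛ : ∀ {n} (a : Vec K.Carrier n) → frobᵛ (ιᵛ a) ≡ ιᵛ a
  frobᵛ-ιᵛ a = trans (sym (map-∘ frob ι a)) (map-cong frob-ι a)

  frobᵛ-lc : ∀ {n d} (c : Vec L.Carrier d) (b : Vec (Vec K.Carrier n) d) →
             frobᵛ (Lⁿ.linearCombination n c (map ιᵛ b)) ≡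
             Lⁿ.linearCombination n (frobᵛ c) (map ιᵛ b)
  frobᵛ-lc {n} []      []      = trans (map-replicate frob L.0# n) (cong (replicate n) frob-0)
  frobᵛ-lc (x ∷ c) (v ∷ b) = trans (plus (map (x L.*_) (ιᵛ v)) _)
    (cong₂ (zipWith L._+_) (trans (scale x (ιᵛ v)) (cong (map (frob x L.*_)) (frobᵛ-ιᵛ v))) (frobᵛ-lc c b))
    where
    plus : ∀ {n} (u v : Vec L.Carrier n) → frobᵛ (zipWith L._+_ u v) ≡ zipWith L._+_ (frobᵛ u) (frobᵛ v)
    plus []      []      = refl
    plus (x ∷ u) (y ∷ v) = cong₂ _∷_ (frob-+ x y) (plus u v)
    scale : ∀ {n} a (v : Vec L.Carrier n) → frobᵛ (map (a L.*_) v) ≡ map (frob a L.*_) (frobᵛ v)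
    scale a []      = refl
    scale a (x ∷ v) = cong₂ _∷_ (frob-* a x) (scale a v)

  rational-span∈Λ : 1 ≤ m → ∀ {n d} (b : Vec (Vec K.Carrier n) d) → Lⁿ.Span n (map ιᵛ b) ∈ Λ E n
  rational-span∈Λ 1≤m {n} b = Combinations.span-isSubspace 𝔽qᵐ (coordinateSpace 𝔽qᵐ n) (map ιᵛ b) ,
    (λ { (v , (c , refl) , refl) → frobᵛ c , sym (frobᵛ-lc c b) }) ,
    λ { (c , refl) → Lⁿ.linearCombination n (root c) (map ιᵛ b) , (root c , refl) ,
          trans (frobᵛ-lc (root c) b) (cong (λ c → Lⁿ.linearCombination n c (map ιᵛ b)) (root-inverse c)) }
    where
    root : ∀ {d} → Vec L.Carrier d → Vec L.Carrier d
    root = map (proj₁ ∘ frob-surjective 1≤m)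
    root-inverse : ∀ {d} (c : Vec L.Carrier d) → frobᵛ (root c) ≡ c
    root-inverse c = trans (sym (map-∘ frob _ c)) (trans (map-cong (proj₂ ∘ frob-surjective 1≤m) c) (map-id c))

  infix 4 _≼_
  _≼_ : ∀ {n} → Vec L.Carrier n → Vec L.Carrier n → Set
  u ≼ v = ∀ i → lookup v i ≡ L.0# → lookup u i ≡ L.0#

  weight : ∀ {n} → Vec L.Carrier n → ℕ
  weight []      = 0
  weight (x ∷ v) with x LF.≟ L.0#
  ... | yes _ = weight v
  ... | no _  = suc (weight v)

  weight-mono : ∀ {n} (u v : Vec L.Carrier n) → u ≼ v → weight u ≤ weight v
  weight-mono []      []      u≼v = z≤n
  weight-mono (x ∷ u) (y ∷ v) u≼v with x LF.≟ L.0# | y LF.≟ L.0#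
  ... | yes _  | yes _  = weight-mono u v (u≼v ∘ suc)
  ... | yes _  | no _   = ℕ.m≤n⇒m≤1+n (weight-mono u v (u≼v ∘ suc))
  ... | no x≢0 | yes y≡0 = contradiction (u≼v zero y≡0) x≢0
  ... | no _   | no _   = s≤s (weight-mono u v (u≼v ∘ suc))

  weight-strict : ∀ {n} (u v : Vec L.Carrier n) i → u ≼ v → lookup u i ≡ L.0# → lookup v i ≢ L.0# →
                  weight u < weight v
  weight-strict (x ∷ u) (y ∷ v) zero u≼v ui≡0 vi≢0 with x LF.≟ L.0# | y LF.≟ L.0#
  ... | no x≢0 | _      = contradiction ui≡0 x≢0
  ... | yes _  | yes ≡0 = contradiction ≡0 vi≢0
  ... | yes _  | no _   = s≤s (weight-mono u v (u≼v ∘ suc))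
  weight-strict (x ∷ u) (y ∷ v) (suc i) u≼v ui≡0 vi≢0 with x LF.≟ L.0# | y LF.≟ L.0#
  ... | yes _  | yes _  = weight-strict u v i (u≼v ∘ suc) ui≡0 vi≢0
  ... | yes _  | no _   = ℕ.m≤n⇒m≤1+n (weight-strict u v i (u≼v ∘ suc) ui≡0 vi≢0)
  ... | no x≢0 | yes y≡0 = contradiction (u≼v zero y≡0) x≢0
  ... | no _   | no _   = s≤s (weight-strict u v i (u≼v ∘ suc) ui≡0 vi≢0)

  zero-or-nonzero-entry : ∀ {n} (v : Vec L.Carrier n) → v ≡ replicate n L.0# ⊎ ∃ λ i → lookup v i ≢ L.0#
  zero-or-nonzero-entry []      = inj₁ refl
  zero-or-nonzero-entry (x ∷ v) with x LF.≟ L.0#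
  ... | no x≢0 = inj₂ (zero , x≢0)
  ... | yes refl with zero-or-nonzero-entry v
  ...   | inj₁ eq       = inj₁ (cong (L.0# ∷_) eq)
  ...   | inj₂ (i , ≢0) = inj₂ (suc i , ≢0)

  module Descent {n : ℕ} {V : Pred (Vec L.Carrier n) 0ℓ} (isSubspace : Lⁿ.IsSubspace n V)
                 (frob-closed : ∀ v → v ∈ V → frobᵛ v ∈ V) where
    open Lⁿ.IsSubspace n isSubspace
    open Difference 𝔽qᵐ (coordinateSpace 𝔽qᵐ n) using (_⊖_; ⊖-+; ⊖≈0⇒≈)
    module Δ = Difference 𝔽qᵐ LD.scalars

    lookup-⊖ : ∀ u v i → lookup (u ⊖ v) i ≡ lookup u i Δ.⊖ lookup v i
    lookup-⊖ u v i = trans (lookup-zipWith L._+_ i u (map (L.- L.1# L.*_) v))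
      (cong (lookup u i L.+_) (lookup-map i _ v))

    -- Once some entry of v is 1, the vector θ(v) − v has strictly smaller
    -- support than v; if it vanishes then v itself is rational.
    rational-below : ∀ s v → weight v < s → v ∈ V → ∀ i → lookup v i ≢ L.0# →
                     ∃₂ λ a j → ιᵛ a ∈ V × ιᵛ a ≼ v × lookup (ιᵛ a) j ≡ L.1#
    rational-below (suc s) v (s≤s v≤s) v∈V i vi≢0 = conclude (zero-or-nonzero-entry u)
      where
      x y : _
      x = lookup v i
      y = proj₁ (L.inverse x vi≢0)

      v′ u : Vec L.Carrier n
      v′ = map (y L.*_) v
      u = frobᵛ v′ ⊖ v′

      v′i≡1 : lookup v′ i ≡ L.1#
      v′i≡1 = trans (lookup-map i _ v) (trans (RL.*-comm y x) (proj₂ (L.inverse x vi≢0)))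

      v′≼v : v′ ≼ v
      v′≼v j vj≡0 = trans (lookup-map j _ v) (trans (cong (y L.*_) vj≡0) (RL.zeroʳ y))

      lookup-u : ∀ j → lookup u j ≡ frob (lookup v′ j) Δ.⊖ lookup v′ j
      lookup-u j = trans (lookup-⊖ (frobᵛ v′) v′ j) (cong (Δ._⊖ lookup v′ j) (lookup-map j frob v′))

      fixed⇒0 : ∀ j → frob (lookup v′ j) ≡ lookup v′ j → lookup u j ≡ L.0#
      fixed⇒0 j eq = trans (lookup-u j) (Δ.≈⇒⊖≈0 eq)

      u≼v : u ≼ v
      u≼v j vj≡0 = fixed⇒0 j (trans (cong frob v′j≡0) (trans frob-0 (sym v′j≡0)))
        where v′j≡0 = v′≼v j vj≡0

      ui≡0 : lookup u i ≡ L.0#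
      ui≡0 = fixed⇒0 i (trans (cong frob v′i≡1) (trans frob-1 (sym v′i≡1)))

      v′∈V : v′ ∈ V
      v′∈V = *ₗ-closed y v∈V

      conclude : u ≡ replicate n L.0# ⊎ (∃ λ j → lookup u j ≢ L.0#) →
                 ∃₂ λ a j → ιᵛ a ∈ V × ιᵛ a ≼ v × lookup (ιᵛ a) j ≡ L.1#
      conclude (inj₁ u≡0) with a , ιa≡v′ ← frobᵛ-fixed⇒rational v′ (⊖≈0⇒≈ u≡0) =
        a , i , subst V (sym ιa≡v′) v′∈V , subst (_≼ v) (sym ιa≡v′) v′≼v ,
        trans (cong (λ w → lookup w i) ιa≡v′) v′i≡1
      conclude (inj₂ (j , uj≢0))
        with a , l , a∈V , a≼u , al≡1 ← rational-below s u
               (ℕ.<-≤-trans (weight-strict u v i u≼v ui≡0 vi≢0) v≤s)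
               (Combinations.⊖-closed 𝔽qᵐ (coordinateSpace 𝔽qᵐ n) isSubspace
                 (frob-closed v′ v′∈V) v′∈V) j uj≢0 =
        a , l , a∈V , (λ t → a≼u t ∘ u≼v t) , al≡1

    spanned-by-rational : ∀ {S : Pred (Vec L.Carrier n) 0ℓ} → Lⁿ.IsSubspace n S →
                          (∀ a → ιᵛ a ∈ V → ιᵛ a ∈ S) → V ⊆ S
    spanned-by-rational {S} S-isSubspace rational {v} = go (suc (weight v)) v ℕ.≤-refl
      where
      module S = Lⁿ.IsSubspace n S-isSubspace
      go : ∀ s v → weight v < s → v ∈ V → v ∈ S
      go (suc s) v (s≤s v≤s) v∈V with zero-or-nonzero-entry v
      ... | inj₁ refl = S.0ᴹ-closed
      ... | inj₂ (i , vi≢0) with rational-below (suc s) v (s≤s v≤s) v∈V i vi≢0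
      ...   | a , j , a∈V , a≼v , aj≡1 = subst S (⊖-+ v (map (x L.*_) (ιᵛ a)))
        (S.+ᴹ-closed (go s u (ℕ.<-≤-trans (weight-strict u v j u≼v uj≡0 vj≢0) v≤s)
            (Combinations.⊖-closed 𝔽qᵐ (coordinateSpace 𝔽qᵐ n) isSubspace v∈V (*ₗ-closed x a∈V)))
          (S.*ₗ-closed x (rational a a∈V)))
        where
        x = lookup v j
        u = v ⊖ map (x L.*_) (ιᵛ a)

        vj≢0 : lookup v j ≢ L.0#
        vj≢0 vj≡0 = L.0≢1 (trans (sym (a≼v j vj≡0)) aj≡1)

        lookup-u : ∀ t → lookup u t ≡ lookup v t Δ.⊖ x L.* lookup (ιᵛ a) t
        lookup-u t = trans (lookup-⊖ v _ t) (cong (lookup v t Δ.⊖_) (lookup-map t _ (ιᵛ a)))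

        uj≡0 : lookup u j ≡ L.0#
        uj≡0 = trans (lookup-u j) (Δ.≈⇒⊖≈0 (sym (trans (cong (x L.*_) aj≡1) (RL.*-identityʳ x))))

        u≼v : u ≼ v
        u≼v t vt≡0 = trans (lookup-u t) (Δ.≈⇒⊖≈0 (trans vt≡0
          (sym (trans (cong (x L.*_) (a≼v t vt≡0)) (RL.zeroʳ x)))))

-- Rank-metric codes

module Code {q m : ℕ} (E : FiniteFieldExtension q m)
            {Γ : Vec (FiniteFieldExtension.L.Carrier E) m}
            (isBasis : FiniteFieldExtension.IsOrderedBasis E Γ)
            {n : ℕ} {C : Pred (Vec (FiniteFieldExtension.L.Carrier E) n) 0ℓ}
            (nondegenerate : RankSupport.Nondegenerate E isBasis C) where
  open FiniteFieldExtension E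
  open RankSupport E isBasis
  open Extension E
  open Support isBasis
  open LD using (_·_; ·-comm; ·-lc)
  private
    module Comb (n : ℕ) = Combinations 𝔽qᵐ (coordinateSpace 𝔽qᵐ n)

  module SmallWeight (primePower : IsPrimePower q) (1≤m : 1 ≤ m) {k : ℕ} (isCode : IsCode E k C) where
    open Frobenius E primePower
    open IsCode isCode

    nonminimal⇒small-weight : ∀ {v v′} → v ∈ C → v′ ∈ C → σʳᵏ v′ ⊆ σʳᵏ v →
      ¬ (∃ λ α → v′ ≡ map (α L.*_) v) →
      ∃ λ d → d ≤ m × Σ (Pred (Vec L.Carrier n) 0ℓ) λ V → V ∈ Λ E n × Lⁿ.HasDimension n V d ×
        (∃ λ s → Lⁿ.HasDimension n (V ∩ C) s × 2 ≤ s)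
    nonminimal⇒small-weight {v} {v′} v∈C v′∈C sub nonproportional =
      d , LF.dimension-≤ (Lⁿ.IsBasis.independent isB) (Lⁿ.IsBasis.members isB) , V ,
      rational-span∈Λ 1≤m (transpose Γ⟨ v ⟩) , (b , isB) ,
      s , (c , isC) , LF.dimension-≤ pair-independent
        (Lⁿ.IsBasis.spanning isC (v′∈V , v′∈C) ∷ Lⁿ.IsBasis.spanning isC (v∈V , v∈C) ∷ [])
      where
      V = Lⁿ.Span n (supportSpace v)
      v∈V = support-⊆⇒∈supportSpace {v = v} {v} id
      v′∈V = support-⊆⇒∈supportSpace {v = v} {v′} sub

      V-basis = LF.basis-exists {P = V} (LF.span? (supportSpace v))
      d = proj₁ V-basis
      b = proj₁ (proj₂ V-basis)
      isB = proj₂ (proj₂ V-basis)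

      V∩C-basis = LF.basis-exists {P = V ∩ C} λ u →
        LF.span? (supportSpace v) u ×-dec LF.subspace? isSubspace hasDimension u
      s = proj₁ V∩C-basis
      c = proj₁ (proj₂ V∩C-basis)
      isC = proj₂ (proj₂ V∩C-basis)

      v≢0 : v ≢ replicate n L.0#
      v≢0 v≡0 = nonproportional (L.0# , trans v′≡0 (sym (LeftModule.*ₗ-zeroˡ (coordinateSpace 𝔽qᵐ n) v)))
        where
        v′≡0 : v′ ≡ replicate n L.0#
        v′≡0 = rational-dual v′ λ y → ⊥support⇒annihilates {v = v′} {y} λ w∈ →
          annihilates⇒⊥support {v = v} {y}
            (trans (cong (ιᵛ y ·_) v≡0) (IsLinear.homo-0 (LD.·-linearʳ (ιᵛ y)))) (sub w∈)

      pair-independent : Lⁿ.LinearlyIndependent n (v′ ∷ v ∷ [])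
      pair-independent = Comb.independent-∷ n LF._≟_
        (Comb.independent-∷ n LF._≟_ {b = []} (λ { [] _ → refl }) λ { ([] , eq) → v≢0 (sym eq) })
        λ { (α ∷ [] , eq) → nonproportional (α ,
              trans (sym eq) (LeftModule.+ᴹ-identityʳ (coordinateSpace 𝔽qᵐ n) _)) }

  module Generator {k : ℕ} {G : Vec (Vec L.Carrier n) k} (isGenerator : IsGeneratorMatrix E G C) where
    private
      module Gen = Lⁿ.IsBasis n isGenerator

    codeword : Vec L.Carrier k → Vec L.Carrier n
    codeword x = Lⁿ.linearCombination n x G

    codeword∈C : Lⁿ.IsSubspace n C → ∀ x → codeword x ∈ C
    codeword∈C isSub x = Comb.lc∈ n isSub x Gen.members

    column : Vec K.Carrier n → Vec L.Carrier k
    column y = map (ιᵛ y ·_) G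

    column-lc : ∀ y → Lⁿ/K.linearCombination k y (transpose G) ≡ column y
    column-lc y = trans (restrict-lc (coordinateSpace 𝔽qᵐ k) y (transpose G)) (LD.lc-transpose (ιᵛ y) G)

    column-linear : IsLinear 𝔽q (coordinateSpace 𝔽q n) (restrict (coordinateSpace 𝔽qᵐ k)) column
    column-linear = record
      { cong-≈ = cong column
      ; homo-+ = λ u v → trans (cong dots (IsLinear.homo-+ ιᵛ-linear u v)) (dots-homo-+ (ιᵛ u) (ιᵛ v))
      ; homo-* = λ a v → trans (cong dots (IsLinear.homo-* ιᵛ-linear a v)) (dots-homo-* (ι a) (ιᵛ v))
      }
      where
      dots = λ y → map (y ·_) G
      open IsLinear (LD.dots-linear G) renaming (homo-+ to dots-homo-+; homo-* to dots-homo-*)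

    ·-column : ∀ x y → x · column y ≡ ιᵛ y · codeword x
    ·-column x y = sym (·-lc (ιᵛ y) x G)

    column-kernel : ∀ y → column y ≡ replicate k L.0# → y ≡ replicate n K.0#
    column-kernel y eq = nondegenerate⇒separated nondegenerate y λ v v∈C →
      let x , xG≡v = Gen.spanning v∈C in begin
      ιᵛ y · v              ≡⟨ cong (ιᵛ y ·_) xG≡v ⟨
      ιᵛ y · codeword x     ≡⟨ ·-column x y ⟨
      x · column y          ≡⟨ cong (x ·_) eq ⟩
      x · replicate k L.0#  ≡⟨ IsLinear.homo-0 (LD.·-linearʳ x) ⟩
      L.0# ∎
      where open ≡-Reasoning

-- The dimension of the code is 2 + k, so k stands for the paper's k − 2.
module CriticalCode {q m k : ℕ} (E : FiniteFieldExtension q m)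
    {Γ : Vec (FiniteFieldExtension.L.Carrier E) m}
    (isBasis : FiniteFieldExtension.IsOrderedBasis E Γ)
    {C : Pred (Vec (FiniteFieldExtension.L.Carrier E) (m ℕ.+ k ℕ.* m)) 0ℓ}
    (nondegenerate : RankSupport.Nondegenerate E isBasis C)
    {G : Vec (Vec (FiniteFieldExtension.L.Carrier E) (m ℕ.+ k ℕ.* m)) (2 ℕ.+ k)}
    (isGenerator : IsGeneratorMatrix E G C) where
  open FiniteFieldExtension E
  open RankSupport E isBasis
  open Extension E
  open Support isBasis
  open LD using (_·_; ·-comm; ·-lc)
  open Code E isBasis nondegenerate
  open Generator isGenerator
  private
    n = m ℕ.+ k ℕ.* m
    Q = q ℕ.^ m
    module Gen = Lⁿ.IsBasis n isGenerator
    module Comb (n : ℕ) = Combinations 𝔽qᵐ (coordinateSpace 𝔽qᵐ n)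
    module S = LeftModule (coordinateSpace 𝔽qᵐ (2 ℕ.+ k))

  module _ {w : Vec (Vec L.Carrier (2 ℕ.+ k)) k}
           (w⊆U : Lⁿ.Span (2 ℕ.+ k) w ⊆ ColumnSystem E G)
           (w-independent : Lⁿ.LinearlyIndependent (2 ℕ.+ k) w)
           {X : Vec (Vec L.Carrier (2 ℕ.+ k)) 2} (X-basis : Lⁿ.IsBasis (2 ℕ.+ k) X (LD.Perp w)) where
    private
      module X = Lⁿ.IsBasis (2 ℕ.+ k) X-basis

    point : Fin (suc Q) → Vec L.Carrier 2
    point zero    = L.0# ∷ L.1# ∷ []
    point (suc i) = L.1# ∷ Inverse.from card-𝔽qᵐ i ∷ []

    at-zero : ∀ a b → point zero · (a ∷ b ∷ []) ≡ b
    at-zero a b = trans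
      (cong₂ L._+_ (RL.zeroˡ a) (trans (RL.+-identityʳ _) (RL.*-identityˡ b))) (RL.+-identityˡ b)

    at-suc : ∀ i a b → point (suc i) · (a ∷ b ∷ []) ≡ a L.+ Inverse.from card-𝔽qᵐ i L.* b
    at-suc i a b = cong₂ L._+_ (RL.*-identityˡ a) (RL.+-identityʳ _)

    on-both : ∀ i {a b} → b ≡ L.0# → point (suc i) · (a ∷ b ∷ []) ≡ L.0# →
              a ∷ b ∷ [] ≡ replicate 2 L.0#
    on-both i {a} refl e = cong (_∷ _) (trans (sym (trans (at-suc i a L.0#)
      (trans (cong (a L.+_) (RL.zeroʳ _)) (RL.+-identityʳ a)))) e)

    points-separate : ∀ p p′ → p ≢ p′ → ∀ z → point p · z ≡ L.0# → point p′ · z ≡ L.0# →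
                      z ≡ replicate 2 L.0#
    points-separate zero    zero     p≢ z            e e′ = contradiction refl p≢
    points-separate zero    (suc j)  p≢ (a ∷ b ∷ []) e e′ = on-both j (trans (sym (at-zero a b)) e) e′
    points-separate (suc i) zero     p≢ (a ∷ b ∷ []) e e′ = on-both i (trans (sym (at-zero a b)) e′) e
    points-separate (suc i) (suc j)  p≢ (a ∷ b ∷ []) e e′ with b LF.≟ L.0#
    ... | yes b≡0 = on-both i b≡0 e
    ... | no b≢0  = contradiction (cong suc (from-injective card-𝔽qᵐ
          (FieldProperties.*-cancelʳ-nonzero 𝔽qᵐ b≢0 (GroupProperties.∙-cancelˡ RL.+-group a _ _
            (trans (sym (at-suc i a b)) (trans e (trans (sym e′) (at-suc j a b)))))))) p≢

    hyperplane : Fin (suc Q) → Vec L.Carrier (2 ℕ.+ k)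
    hyperplane p = Lⁿ.linearCombination (2 ℕ.+ k) (point p) X

    Meets : Fin (suc Q) → Pred (Vec K.Carrier n) 0ℓ
    Meets p y = hyperplane p · column y ≡ L.0# × ¬ column y ∈ Lⁿ.Span (2 ℕ.+ k) w

    meets? : ∀ p → Decidable (Meets p)
    meets? p y = (hyperplane p · column y LF.≟ L.0#) ×-dec ¬? (LF.span? w (column y))

    hyperplane⊥ : ∀ p u c → hyperplane p · (u S.+ᴹ Lⁿ.linearCombination (2 ℕ.+ k) c w) ≡ hyperplane p · u
    hyperplane⊥ p u c = begin
      h · (u S.+ᴹ Lⁿ.linearCombination (2 ℕ.+ k) c w)      ≡⟨ IsLinear.homo-+ (LD.·-linearʳ h) u _ ⟩
      h · u L.+ h · Lⁿ.linearCombination (2 ℕ.+ k) c w     ≡⟨ cong (h · u L.+_) (LD.perp-span {b = w} {h}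
        (Comb.lc∈ (2 ℕ.+ k) (LD.perp-isSubspace w) (point p) X.members) (c , refl)) ⟩
      h · u L.+ L.0#                                       ≡⟨ RL.+-identityʳ _ ⟩
      h · u ∎
      where
      open ≡-Reasoning
      h = hyperplane p

    X⊥⇒∈span : ∀ {u} → u ∈ LD.Perp X → u ∈ Lⁿ.Span (2 ℕ.+ k) w
    X⊥⇒∈span {u} u⊥X = LF.perp-perp⊆span w λ y y⊥w →
      trans (·-comm y u) (LD.perp-span {b = X} {u} u⊥X (X.spanning y⊥w))

    -- (p , c) ↦ y p + φ⁻¹(Σ c w) would embed a set of (qᵐ + 1)·(qᵐ)ᵏ elements
    -- in 𝔽qⁿ, which has only qᵐ·(qᵐ)ᵏ.
    not-all-meet : ¬ (∀ p → ∃ (Meets p))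
    not-all-meet meets = ℕ.<⇒≱ too-many (injection⇒≤
      (×-card (↔-id (Fin (suc Q))) (Vec-card card-𝔽qᵐ k)) (Vec-card card-𝔽q n) f f-injective)
      where
      open ≡-Reasoning
      y : Fin (suc Q) → Vec K.Carrier n
      y = proj₁ ∘ meets

      lift : ∀ c → ColumnSystem E G (Lⁿ.linearCombination (2 ℕ.+ k) c w)
      lift c = w⊆U (c , refl)

      f : Fin (suc Q) × Vec L.Carrier k → Vec K.Carrier n
      f (p , c) = zipWith K._+_ (y p) (proj₁ (lift c))

      column-f : ∀ p c → column (f (p , c)) ≡ column (y p) S.+ᴹ Lⁿ.linearCombination (2 ℕ.+ k) c w
      column-f p c = trans (IsLinear.homo-+ column-linear (y p) (proj₁ (lift c)))
        (cong (column (y p) S.+ᴹ_) (trans (sym (column-lc (proj₁ (lift c)))) (proj₂ (lift c))))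

      f-injective : Injective _≡_ _≡_ f
      f-injective {p , c} {p′ , c′} eq with p Fin.≟ p′
      ... | yes refl = cong (p ,_) (Comb.independent⇒injective (2 ℕ.+ k) w w-independent c c′
              (GroupProperties.∙-cancelˡ S.+ᴹ-group (column (y p)) _ _
                (trans (sym (column-f p c)) (trans (cong column eq) (column-f p c′)))))
      ... | no p≢p′ = contradiction (X⊥⇒∈span (points-separate p p′ p≢p′ _
              (on-X p (proj₁ (proj₂ (meets p)))) (on-X p′ (begin
                hyperplane p′ · column (y p)          ≡⟨ hyperplane⊥ p′ (column (y p)) c ⟨
                hyperplane p′ · (column (y p) S.+ᴹ _) ≡⟨ cong (hyperplane p′ ·_) (column-f p c) ⟨
                hyperplane p′ · column (f (p , c))    ≡⟨ cong (λ z → hyperplane p′ · column z) eq ⟩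
                hyperplane p′ · column (f (p′ , c′))  ≡⟨ cong (hyperplane p′ ·_) (column-f p′ c′) ⟩
                hyperplane p′ · (column (y p′) S.+ᴹ _) ≡⟨ hyperplane⊥ p′ (column (y p′)) c′ ⟩
                hyperplane p′ · column (y p′)         ≡⟨ proj₁ (proj₂ (meets p′)) ⟩
                L.0# ∎))))
              (proj₂ (proj₂ (meets p)))
        where
        on-X : ∀ p″ → hyperplane p″ · column (y p) ≡ L.0# → point p″ · map (column (y p) ·_) X ≡ L.0#
        on-X p″ e = trans (sym (·-lc (column (y p)) (point p″) X))
          (trans (·-comm (column (y p)) (hyperplane p″)) e)

      too-many : q ℕ.^ n < suc Q ℕ.* Q ℕ.^ k
      too-many = subst (_< suc Q ℕ.* Q ℕ.^ k) (sym qⁿ≡)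
        (ℕ.m<n+m (Q ℕ.* Q ℕ.^ k) (ℕ.m^n>0 Q {{ℕ.>-nonZero (ℕ.<⇒≤ LF.1<card)}} k))
        where
        qⁿ≡ : q ℕ.^ n ≡ Q ℕ.* Q ℕ.^ k
        qⁿ≡ = trans (ℕ.^-distribˡ-+-* q m (k ℕ.* m))
          (cong (Q ℕ.*_) (trans (cong (q ℕ.^_) (ℕ.*-comm k m)) (sym (ℕ.^-*-assoc q m k))))

    avoiding⇒¬minimal : Lⁿ.IsSubspace n C → ∀ p → ¬ (∃ (Meets p)) → ¬ Minimal C
    avoiding⇒¬minimal isSub p avoids minimal = ℕ.<⇒≱ ℕ.≤-refl
      (LF.dimension-≤ {b = hyperplane p ∷ []} X.independent (AllVec.map proportional X.members))
      where
      proportional : ∀ {x} → x ∈ LD.Perp w → x ∈ Lⁿ.Span (2 ℕ.+ k) (hyperplane p ∷ [])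
      proportional {x} x⊥w = α ∷ [] , trans (S.+ᴹ-identityʳ _) (sym
          (Comb.independent⇒injective n G Gen.independent x (map (α L.*_) (hyperplane p))
            (trans x≡ (sym (Comb.lc-* n G α (hyperplane p))))))
        where
        open ≡-Reasoning
        result = minimal (codeword (hyperplane p)) (codeword x)
          (codeword∈C isSub (hyperplane p)) (codeword∈C isSub x)
          (support-⊆ {v = codeword (hyperplane p)} {codeword x} λ y e →
            trans (sym (·-column x y)) (LD.perp-span {b = w} {x} x⊥w
              (decidable-stable (LF.span? w (column y)) λ ∉ →
                avoids (y , trans (·-column (hyperplane p) y) e , ∉))))
        α = proj₁ result
        x≡ = proj₂ result

    span⊆system⇒¬minimal : Lⁿ.IsSubspace n C → ¬ Minimal C
    span⊆system⇒¬minimal isSub = avoiding⇒¬minimal isSub (proj₁ avoiding) (proj₂ avoiding)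
      where
      avoiding : ∃ λ p → ¬ (∃ (Meets p))
      avoiding = ¬∀⟶∃¬ (suc Q) (∃ ∘ Meets) (λ p → KF.anyᵛ? (meets? p)) not-all-meet

  linear-subspace⇒¬minimal : {w : Vec (Vec L.Carrier (2 ℕ.+ k)) k} →
    Lⁿ.Span (2 ℕ.+ k) w ⊆ ColumnSystem E G → Lⁿ.LinearlyIndependent (2 ℕ.+ k) w →
    Lⁿ.IsSubspace n C → ¬ Minimal C
  linear-subspace⇒¬minimal {w} w⊆U indep =
    span⊆system⇒¬minimal w⊆U indep (proj₂ (LF.perp-has-dimension refl w indep))

  module _ {V : Pred (Vec L.Carrier n) 0ℓ} (V-isSubspace : Lⁿ.IsSubspace n V)
           {d : ℕ} (V-hasDimension : Lⁿ.HasDimension n V d) (d≤m : d ≤ m)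
           (primePower : IsPrimePower q) (frob-closed : ∀ v → v ∈ V → θ E v ∈ V) where
    open Frobenius E primePower
    open Descent V-isSubspace frob-closed
    private
      module RC = Combinations 𝔽q (restrict (coordinateSpace 𝔽qᵐ (2 ℕ.+ k)))

    Rational : Pred (Vec K.Carrier n) 0ℓ
    Rational a = ιᵛ a ∈ V

    -- If w ∈ X^⊥ is not in U, then w and the images of a basis of the
    -- orthogonal of the rational points of V are n − dim V + 1 > km
    -- independent vectors over 𝔽q in X^⊥, which has only (qᵐ)ᵏ elements.
    perp-vector-is-column :
      ∀ {e} {a : Vec (Vec K.Carrier n) e} → Kⁿ.IsBasis n a Rational →
      ∀ {s} {z : Vec (Vec K.Carrier n) s} → s ℕ.+ e ≡ n → Kⁿ.IsBasis n z (KD.Perp a) →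
      ∀ {X : Vec (Vec L.Carrier (2 ℕ.+ k)) 2} → AllVec (λ x → codeword x ∈ V) X →
      Lⁿ.HasDimension (2 ℕ.+ k) (LD.Perp X) k →
      ∀ {w} → w ∈ LD.Perp X → ¬ ¬ (∃ λ y → column y ≡ w)
    perp-vector-is-column {e} {a} a-basis {s} {z} s+e≡n z-basis {X} X∈ (W , W-basis) {w} w⊥X ∄y =
      contradiction km≤s (ℕ.<⇒≱ s<km)
      where
      module A = Kⁿ.IsBasis n a-basis
      module Z = Kⁿ.IsBasis n z-basis

      e≤m : e ≤ m
      e≤m = ℕ.≤-trans (LF.dimension-≤ {b = proj₁ V-hasDimension} (ι-independent {b = a} A.independent)
        (map⁺ (AllVec.map (Lⁿ.IsBasis.spanning (proj₂ V-hasDimension)) A.members))) d≤m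

      km≤s : m ℕ.* k ≤ s
      km≤s = subst (_≤ s) (ℕ.*-comm k m) (ℕ.+-cancelˡ-≤ m _ _ (ℕ.≤-trans (ℕ.≤-reflexive (sym s+e≡n))
        (ℕ.≤-trans (ℕ.+-monoʳ-≤ s e≤m) (ℕ.≤-reflexive (ℕ.+-comm s m)))))

      V⊆ : V ⊆ Lⁿ.Span n (map ιᵛ a)
      V⊆ = spanned-by-rational (Combinations.span-isSubspace 𝔽qᵐ (coordinateSpace 𝔽qᵐ n) (map ιᵛ a))
        λ u u∈V → ι-span {b = a} {u} (A.spanning u∈V)

      column∈ : ∀ {y} → y ∈ KD.Perp a → column y ∈ LD.Perp X
      column∈ {y} y⊥a = orthogonal X∈
        where
        orthogonal : ∀ {r} {X : Vec (Vec L.Carrier (2 ℕ.+ k)) r} → AllVec (λ x → codeword x ∈ V) X →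
                     column y ∈ LD.Perp X
        orthogonal []                 = refl
        orthogonal {X = x ∷ X} (p ∷ ps) = cong₂ _∷_
          (trans (·-comm (column y) x) (trans (·-column x y)
            (LD.perp-span {b = map ιᵛ a} {ιᵛ y} (ι-perp {b = a} {y} y⊥a) (V⊆ p))))
          (orthogonal ps)

      B : Vec (Vec L.Carrier (2 ℕ.+ k)) (suc s)
      B = w ∷ map column z

      B-independent : Lⁿ/K.LinearlyIndependent (2 ℕ.+ k) B
      B-independent = RC.independent-∷ KF._≟_
        (map-independent 𝔽q column-linear column-kernel Z.independent)
        λ (c , eq) → ∄y (Kⁿ.linearCombination n c z , trans (lc-homo 𝔽q column-linear c z) eq)

      B∈ : AllVec (LD.Perp X) B
      B∈ = w⊥X ∷ map⁺ (AllVec.map (λ {y} → column∈ {y}) Z.members)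

      s<km : s < m ℕ.* k
      s<km = ^-cancelʳ-≤ KF.1<card (subst (q ℕ.^ suc s ≤_) (ℕ.^-*-assoc q m k)
        (KF.independent-count (restrict (coordinateSpace 𝔽qᵐ (2 ℕ.+ k))) B-independent
          (Vec-card card-𝔽qᵐ k) (λ c → Lⁿ.linearCombination (2 ℕ.+ k) c W)
          λ c → Lⁿ.IsBasis.spanning W-basis
            (RC.lc∈ (restrict-subspace {coordinateSpace 𝔽qᵐ (2 ℕ.+ k)} (LD.perp-isSubspace X)) c B∈)))

    perp-in-columns : ∀ {X : Vec (Vec L.Carrier (2 ℕ.+ k)) 2} → AllVec (λ x → codeword x ∈ V) X →
                      Lⁿ.HasDimension (2 ℕ.+ k) (LD.Perp X) k → LD.Perp X ⊆ ColumnSystem E G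
    perp-in-columns X∈ W {w} w⊥X = proj₁ y , trans (column-lc (proj₁ y)) (proj₂ y)
      where
      rational-basis : ∃ (Kⁿ.HasDimension n Rational)
      rational-basis = KF.basis-exists λ a → LF.subspace? V-isSubspace V-hasDimension (ιᵛ a)

      a-basis = proj₂ (proj₂ rational-basis)
      perp = KF.perp-dimension (proj₁ (proj₂ rational-basis)) (Kⁿ.IsBasis.independent a-basis)

      y : ∃ λ y → column y ≡ w
      y = decidable-stable (KF.anyᵛ? λ y → column y LF.≟ᵛ w) (perp-vector-is-column a-basis
        (proj₁ (proj₂ perp)) (proj₂ (proj₂ (proj₂ perp))) X∈ W w⊥X)

    LinearSubspace : Set₁
    LinearSubspace = Σ (Pred (Vec L.Carrier (2 ℕ.+ k)) 0ℓ) λ H → Lⁿ.IsSubspace (2 ℕ.+ k) H ×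
      Lⁿ.HasDimension (2 ℕ.+ k) H k × H ⊆ ColumnSystem E G

    linear-subspace : ∀ {s} → Lⁿ.HasDimension n (V ∩ C) s → 2 ≤ s → LinearSubspace
    linear-subspace {s} (b , b-basis) 2≤s = from-basis (s ℕ.∸ 2) (ℕ.m∸n+n≡m 2≤s) b b-basis
      where
      from-messages : (X : Vec (Vec L.Carrier (2 ℕ.+ k)) 2) → AllVec (λ x → codeword x ∈ V) X →
                      Lⁿ.LinearlyIndependent n (map codeword X) → LinearSubspace
      from-messages X X∈ indep = LD.Perp X , LD.perp-isSubspace X , W , perp-in-columns X∈ W
        where
        W = LF.perp-has-dimension (ℕ.+-comm k 2) X (map-independent⁻ 𝔽qᵐ (Comb.lc-linear n G) indep)

      messages : ∀ {r} {vs : Vec (Vec L.Carrier n) r} → AllVec (V ∩ C) vs →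
                 ∃ λ X → map codeword X ≡ vs × AllVec (λ x → codeword x ∈ V) X
      messages []                 = [] , refl , []
      messages ((v∈V , v∈C) ∷ ps) with Gen.spanning v∈C | messages ps
      ... | x , refl | X , refl , X∈ = x ∷ X , refl , v∈V ∷ X∈

      from-pair : ∀ {vs : Vec (Vec L.Carrier n) 2} → Lⁿ.LinearlyIndependent n vs →
                  (∃ λ X → map codeword X ≡ vs × AllVec (λ x → codeword x ∈ V) X) → LinearSubspace
      from-pair indep (X , refl , X∈) = from-messages X X∈ indep

      from-basis : ∀ {s} r → r ℕ.+ 2 ≡ s → (b : Vec (Vec L.Carrier n) s) → Lⁿ.IsBasis n b (V ∩ C) →
                   LinearSubspace
      from-basis r refl b b-basis = from-pair (proj₂ (proj₂ pair)) (messages (proj₁ (proj₂ pair)))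
        where
        pair = Comb.independent-drop n r b (Lⁿ.IsBasis.members b-basis) (Lⁿ.IsBasis.independent b-basis)

open import Data.Nat.Base using (_*_; _∸_)

corollary6p19 : ∀ {q m k : ℕ} → IsPrimePower q → 1 ≤ m → 2 ≤ k →
    (E : FiniteFieldExtension q m) → let open FiniteFieldExtension E in
    (Γ : Vec L.Carrier m) (isBasis : IsOrderedBasis Γ) → let open RankSupport E isBasis in
    (C : Pred (Vec L.Carrier ((k ∸ 1) * m)) 0ℓ) → IsCode E k C → Nondegenerate C →
    (ℓ d₂ : ℕ) → IsLinearityIndex E k C ℓ → IsGeneralizedRankWeight E 2 C d₂ →
    (Minimal C ⇔ ℓ < k ∸ 2) × (ℓ < k ∸ 2 ⇔ m < d₂)
corollary6p19 {q} {m} {suc (suc k)} primePower 1≤m (s≤s (s≤s z≤n)) E Γ isBasis C isCode nondegenerate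
  ℓ d₂ (G , isGenerator , (H , H-isSubspace , (h , h-basis) , H⊆U) , ℓ-maximal)
  ((V , (V-isSubspace , θV≐V) , V-hasDimension , s , V∩C-hasDimension , 2≤s) , d₂-minimal) =
  mk⇔ minimal⇒ℓ<k (d₂>m⇒minimal ∘ ℓ<k⇒d₂>m) , mk⇔ ℓ<k⇒d₂>m (minimal⇒ℓ<k ∘ d₂>m⇒minimal)
  where
  open FiniteFieldExtension E
  open RankSupport E isBasis
  module Critical = CriticalCode E isBasis nondegenerate isGenerator
  module Comb = Combinations 𝔽qᵐ (coordinateSpace 𝔽qᵐ (2 ℕ.+ k))

  minimal⇒ℓ<k : Minimal C → ℓ < k
  minimal⇒ℓ<k minimal = ℕ.≰⇒> λ k≤ℓ → not-minimal (ℓ ℕ.∸ k) (ℕ.m∸n+n≡m k≤ℓ) h h-basis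
    where
    not-minimal : ∀ {ℓ} r → r ℕ.+ k ≡ ℓ → (h : Vec (Vec L.Carrier (2 ℕ.+ k)) ℓ) →
                  Lⁿ.IsBasis (2 ℕ.+ k) h H → ⊥
    not-minimal r refl h h-basis = Critical.linear-subspace⇒¬minimal
      (λ u∈ → H⊆U (Comb.span⊆ H-isSubspace (proj₁ (proj₂ w)) u∈)) (proj₂ (proj₂ w))
      (IsCode.isSubspace isCode) minimal
      where
      w = Comb.independent-drop r h (Lⁿ.IsBasis.members h-basis) (Lⁿ.IsBasis.independent h-basis)

  ℓ<k⇒d₂>m : ℓ < k → m < d₂
  ℓ<k⇒d₂>m ℓ<k = ℕ.≰⇒> λ d₂≤m → ℕ.<⇒≱ ℓ<k (ℓ-maximal k (Critical.linear-subspace V-isSubspace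
    V-hasDimension d₂≤m primePower (λ v v∈V → proj₁ θV≐V (v , v∈V , refl)) V∩C-hasDimension 2≤s))

  d₂>m⇒minimal : m < d₂ → Minimal C
  d₂>m⇒minimal m<d₂ v v′ v∈C v′∈C sub = decidable-stable
    (Finite.any? card-𝔽qᵐ λ α → FiniteLinearAlgebra._≟ᵛ_ 𝔽qᵐ card-𝔽qᵐ v′ (map (α L.*_) v))
    λ ∄α → not-small (Code.SmallWeight.nonminimal⇒small-weight E isBasis nondegenerate
      primePower 1≤m isCode v∈C v′∈C sub ∄α)
    where
    not-small : ¬ (∃ λ d → d ≤ m × _)
    not-small (d , d≤m , weight) = ℕ.<⇒≱ m<d₂ (ℕ.≤-trans (d₂-minimal d weight) d≤m)
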